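{- Let $\theta$ be a large enough regular cardinal, $(X,\tau)\in H(\theta)$ a countably tight topological space, and $\mathbb{P}\in H(\theta)$ a poset. Suppose that the set of countable $M\prec H(\theta)$ such that $\mathbb{P}$ is strongly proper for $M$ is stationary in $[H(\theta)]^{\aleph_0}$. Then $\mathbb{P}$ forces that $(X,\tau)$ is countably tight.
   Context: $H(\theta)$ is the collection of sets hereditarily of cardinality $<\theta$; "large enough" has its usual meaning ($\theta\ge\omega_2$ and $H(\theta)$ contains all relevant objects, such as power sets, topologies, and names built from $\mathbb{P}$ and $X$). Strong properness. Let $M\prec H(\theta)$ be countable with $\mathbb{P}\in M$. For $q\in\mathbb{P}$, a condition $\bar q\in M\cap\mathbb{P}$ is a residue of $q$ to $M$ if every $s\le\bar q$ with $s\in M$ is compatible with $q$. A condition $p\in\mathbb{P}$ is $(M,\mathbb{P})$-strongly generic if every $q\le p$ has a residue to $M$. $\mathbb{P}$ is strongly proper for $M$ if every $s\in M\cap\mathbb{P}$ can be extended to an $(M,\mathbb{P})$-strongly generic condition. Preservation. If $G$ is $V$-generic over $\mathbb{P}$, then $\tau^G$ denotes the topology on $X$ in $V[G]$ having $\tau$ as a basis. "$\mathbb{P}$ forces that $(X,\tau)$ has property $\Phi$" means that every condition forces that $(X,\tau^{\dot G})$ has property $\Phi$. A space $X$ is countably tight if for every $x\in X$ and every $A\subseteq X$ with $x\in\mathrm{cl}(A)$ there is a countable $B\subseteq A$ with $x\in\mathrm{cl}(B)$. -}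

module Defs where

open import Level using (0ℓ; Lift) renaming (suc to lsuc)
open import Data.Bool using (Bool; true; false; if_then_else_; T)
open import Data.Empty using (⊥)
open import Data.Fin using (Fin)
open import Data.Maybe using (Maybe; just; nothing; maybe′)
open import Data.Nat using (ℕ; zero) renaming (suc to sucℕ)
open import Data.Product using (Σ; ∃; _×_; _,_; proj₁; proj₂)
open import Data.Sum using (_⊎_)
open import Data.Vec.Functional using (Vector; _∷_)
open import Function using (id; _∘_)
open import Function.Bundles using (_⇔_)
open import Relation.Nullary using (¬_)

infix 4 _≐_ _∈_ _⊆_

-- The universe of sets: well-founded trees up to bisimulation.  Together with
-- excluded middle for Set₁ (which makes every class-defined subset of a set
-- small) and `Choice` below, this is a universe of ZFC sets.

data V : Set₁ where
  sup : (I : Set) → (I → V) → V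

Ix : V → Set
Ix (sup I _) = I

el : (x : V) → Ix x → V
el (sup _ f) = f

_≐_ : V → V → Set
sup I f ≐ sup J g = (∀ i → ∃ λ j → f i ≐ g j) × (∀ j → ∃ λ i → f i ≐ g j)

≐-refl : ∀ x → x ≐ x
≐-refl (sup I f) = (λ i → i , ≐-refl (f i)) , (λ i → i , ≐-refl (f i))

_∈_ : V → V → Set
x ∈ y = ∃ λ j → x ≐ el y j

_⊆_ : V → V → Set₁
x ⊆ y = ∀ z → z ∈ x → z ∈ y

Class : Set₂
Class = V → Set₁

⋃ : V → V
⋃ x = sup (Σ (Ix x) λ i → Ix (el x i)) λ (i , j) → el (el x i) j

_∩_ : V → V → V
x ∩ y = sup (Σ (Ix x) λ i → el x i ∈ y) (el x ∘ proj₁)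

｛_,_｝ : V → V → V
｛ x , y ｝ = sup Bool λ b → if b then x else y

⟨_,_⟩ : V → V → V
⟨ x , y ⟩ = ｛ ｛ x , x ｝ , ｛ x , y ｝ ｝

_×ˢ_ : V → V → V
x ×ˢ y = sup (Ix x × Ix y) λ (i , j) → ⟨ el x i , el y j ⟩

-- Bool-valued characteristic functions give all subsets by excluded middle.
𝒫 : V → V
𝒫 x = sup (Ix x → Bool) λ χ → sup (Σ (Ix x) (T ∘ χ)) (el x ∘ proj₁)

numeral : ℕ → V
numeral zero     = sup ⊥ λ ()
numeral (sucℕ n) = sup (Maybe (Ix (numeral n))) (maybe′ (el (numeral n)) (numeral n))

ω : V
ω = sup ℕ numeral

trcl : V → V
trcl (sup I f) =
  sup (Σ I λ i → Maybe (Ix (trcl (f i)))) λ (i , j) → maybe′ (el (trcl (f i))) (f i) j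

Choice : Set₁
Choice = ∀ a →
  (∀ x → x ∈ a → ∃ λ y → y ∈ x) →
  (∀ x y z → x ∈ a → y ∈ a → z ∈ x → z ∈ y → x ≐ y) →
  ∃ λ c → ∀ x → x ∈ a →
    ∃ λ y → (y ∈ x × y ∈ c) × (∀ y′ → y′ ∈ x → y′ ∈ c → y′ ≐ y)

-- An interpretation of the language of set theory.  Properties that are
-- considered both in V and in the forcing extension are written once, over an
-- arbitrary interpretation; Ω is the type of truth values.

record Logic : Set₃ where
  infix  7 _ε_ _≈_
  infixr 6 _∧_
  infixr 5 _∨_
  infixr 4 _⊃_
  field
    Dom         : Set₁
    Ω           : Set₂
    _ε_ _≈_     : Dom → Dom → Ω
    ⊥′          : Ω
    _∧_ _∨_ _⊃_ : Ω → Ω → Ω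
    All Ex      : (Dom → Ω) → Ω

module Notions (L : Logic) where
  open Logic L

  infixr 3 _⇔′_
  infix  7 _⊑_ _≼_

  _⇔′_ : Ω → Ω → Ω
  φ ⇔′ ψ = (φ ⊃ ψ) ∧ (ψ ⊃ φ)

  All∈ Ex∈ : Dom → (Dom → Ω) → Ω
  All∈ a φ = All λ x → x ε a ⊃ φ x
  Ex∈  a φ = Ex  λ x → x ε a ∧ φ x

  _⊑_ : Dom → Dom → Ω
  a ⊑ b = All∈ a λ x → x ε b

  IsUnorderedPair IsPair : Dom → Dom → Dom → Ω
  IsUnorderedPair u a b = All λ v → v ε u ⇔′ (v ≈ a ∨ v ≈ b)
  IsPair z a b = All λ u → u ε z ⇔′ (IsUnorderedPair u a a ∨ IsUnorderedPair u a b)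

  Related : Dom → Dom → Dom → Ω
  Related f a b = Ex∈ f λ z → IsPair z a b

  IsFunction IsInjection IsBijection : Dom → Dom → Dom → Ω
  IsFunction f a b =
    (All∈ f λ z → Ex∈ a λ x → Ex∈ b λ y → IsPair z x y)
    ∧ (All∈ a λ x → Ex∈ b λ y → Related f x y)
    ∧ (All λ x → All λ y → All λ y′ → Related f x y ⊃ Related f x y′ ⊃ y ≈ y′)
  IsInjection f a b =
    IsFunction f a b
    ∧ (All λ x → All λ x′ → All λ y → Related f x y ⊃ Related f x′ y ⊃ x ≈ x′)
  IsBijection f a b =
    IsInjection f a b ∧ (All∈ b λ y → Ex∈ a λ x → Related f x y)

  _≼_ : Dom → Dom → Ω
  a ≼ b = Ex λ f → IsInjection f a b

  Inductive : Dom → Ω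
  Inductive w =
    (Ex∈ w λ e → All λ x → x ε e ⊃ ⊥′)
    ∧ (All∈ w λ n → Ex∈ w λ s → All λ x → x ε s ⇔′ (x ε n ∨ x ≈ n))

  IsOmega : Dom → Ω
  IsOmega w = Inductive w ∧ (All λ v → Inductive v ⊃ w ⊑ v)

  Countable : Dom → Ω
  Countable a = Ex λ w → IsOmega w ∧ a ≼ w

  -- A topology is passed as its predicate of open sets.

  InClosure : (Dom → Ω) → Dom → Dom → Ω
  InClosure Open x A = All λ U → Open U ⊃ x ε U ⊃ Ex∈ A λ y → y ε U

  CountablyTight : Dom → (Dom → Ω) → Ω
  CountablyTight X Open =
    All∈ X λ x → All λ A → A ⊑ X ⊃ InClosure Open x A ⊃
      (Ex λ B → B ⊑ A ∧ Countable B ∧ InClosure Open x B)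

  OpenGeneratedBy : Dom → Dom → Dom → Ω
  OpenGeneratedBy X β U = U ⊑ X ∧ (All∈ U λ x → Ex∈ β λ W → x ε W ∧ W ⊑ U)

Tarski : (D : Set₁) → (D → V) → Logic
Tarski D ι = record
  { Dom = D
  ; Ω   = Set₁
  ; _ε_ = λ x y → Lift (lsuc 0ℓ) (ι x ∈ ι y)
  ; _≈_ = λ x y → Lift (lsuc 0ℓ) (ι x ≐ ι y)
  ; ⊥′  = Lift (lsuc 0ℓ) ⊥
  ; _∧_ = _×_
  ; _∨_ = _⊎_
  ; _⊃_ = λ φ ψ → φ → ψ
  ; All = λ φ → ∀ x → φ x
  ; Ex  = λ φ → ∃ φ
  }

module InV = Notions (Tarski V id)

infix  7 _ε_ _≈_
infixr 6 _∧_
infixr 5 _∨_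
infixr 4 _⊃_

-- De Bruijn indices: in All φ and Ex φ the bound variable is index zero.
data Formula : ℕ → Set where
  _ε_ _≈_     : ∀ {n} → Fin n → Fin n → Formula n
  ⊥′          : ∀ {n} → Formula n
  _∧_ _∨_ _⊃_ : ∀ {n} → Formula n → Formula n → Formula n
  All Ex      : ∀ {n} → Formula (sucℕ n) → Formula n

module Satisfaction (L : Logic) where
  private module L = Logic L

  ⟦_⟧ : ∀ {n} → Formula n → Vector L.Dom n → L.Ω
  ⟦ i ε j ⟧ ρ = ρ i L.ε ρ j
  ⟦ i ≈ j ⟧ ρ = ρ i L.≈ ρ j
  ⟦ ⊥′ ⟧    ρ = L.⊥′
  ⟦ φ ∧ ψ ⟧ ρ = ⟦ φ ⟧ ρ L.∧ ⟦ ψ ⟧ ρ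
  ⟦ φ ∨ ψ ⟧ ρ = ⟦ φ ⟧ ρ L.∨ ⟦ ψ ⟧ ρ
  ⟦ φ ⊃ ψ ⟧ ρ = ⟦ φ ⟧ ρ L.⊃ ⟦ ψ ⟧ ρ
  ⟦ All φ ⟧ ρ = L.All λ x → ⟦ φ ⟧ (x ∷ ρ)
  ⟦ Ex φ ⟧  ρ = L.Ex λ x → ⟦ φ ⟧ (x ∷ ρ)

infix 4 _≺_

_≺_ : V → Class → Set₁
M ≺ A = Σ (∀ x → x ∈ M → A x) λ M⊆A →
  ∀ {n} (φ : Formula n) (ρ : Vector (Σ V (_∈ M)) n) →
    Satisfaction.⟦_⟧ (Tarski (Σ V (_∈ M)) proj₁) φ ρ
    ⇔ Satisfaction.⟦_⟧ (Tarski (Σ V A) proj₁) φ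
        (λ i → proj₁ (ρ i) , M⊆A _ (proj₂ (ρ i)))

Transitive : V → Set₁
Transitive x = ∀ y → y ∈ x → y ⊆ x

Ordinal : V → Set₁
Ordinal α = Transitive α × (∀ β → β ∈ α → Transitive β)

Cardinal : V → Set₁
Cardinal κ = Ordinal κ × (∀ α → α ∈ κ → ¬ (κ InV.≼ α))

RegularCardinal : V → Set₁
RegularCardinal θ = Cardinal θ × (ω ⊆ θ) ×
  (∀ α → α ∈ θ → ∀ f → InV.IsFunction f α θ →
    ∃ λ β → β ∈ θ × (∀ ξ η → InV.Related f ξ η → η ∈ β))

IsSuccessorCardinal : V → V → Set₁
IsSuccessorCardinal κ⁺ κ =
  Cardinal κ⁺ × κ ∈ κ⁺ × (∀ μ → Cardinal μ → κ ∈ μ → κ⁺ ⊆ μ)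

ω₂≤ : V → Set₁
ω₂≤ θ = ∃ λ ω₁ → ∃ λ ω₂ →
  IsSuccessorCardinal ω₁ ω × IsSuccessorCardinal ω₂ ω₁ × ω₂ ⊆ θ

H : V → Class
H θ x = ∃ λ α → α ∈ θ × trcl x InV.≼ α

[_]^ℵ₀ : Class → Class
[ A ]^ℵ₀ M = (∀ x → x ∈ M → A x) × (∃ λ f → InV.IsBijection f M ω)

-- Subsets of [A]^ℵ₀ are given as classes.  For A = H θ, which is a set, this
-- is the same as quantifying over sets, by separation.

record Club (A : Class) (C : Class) : Set₁ where
  field
    extensional : ∀ {M N} → M ≐ N → C M → C N
    subclass    : ∀ M → C M → [ A ]^ℵ₀ M
    unbounded   : ∀ a → [ A ]^ℵ₀ a → ∃ λ M → C M × a ⊆ M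
    closed      : (c : ℕ → V) → (∀ n → C (c n)) → (∀ n → c n ⊆ c (sucℕ n)) →
                  C (⋃ (sup ℕ c))

StationaryIn : Class → Class → Set₂
StationaryIn A S = (C : Class) → Club A C → ∃ λ M → C M × S M

record TopSpace : Set₁ where
  field
    X τ    : V
    τ⊆𝒫X   : ∀ U → U ∈ τ → U ⊆ X
    X-open : X ∈ τ
    ⋃-open : ∀ S → S ⊆ τ → ⋃ S ∈ τ
    ∩-open : ∀ U W → U ∈ τ → W ∈ τ → (U ∩ W) ∈ τ

  code : V
  code = ⟨ X , τ ⟩

record Poset : Set₁ where
  infix 4 _≤_
  field
    carrier order : V

  Cond : Set₁
  Cond = Σ V (_∈ carrier)

  _≤_ : Cond → Cond → Set
  p ≤ q = ⟨ proj₁ p , proj₁ q ⟩ ∈ order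

  field
    order⊆        : order ⊆ (carrier ×ˢ carrier)
    reflexive     : ∀ p → p ≤ p
    transitive    : ∀ p q r → p ≤ q → q ≤ r → p ≤ r
    antisymmetric : ∀ p q → p ≤ q → q ≤ p → proj₁ p ≐ proj₁ q

  code : V
  code = ⟨ carrier , order ⟩

  Compatible : Cond → Cond → Set₁
  Compatible p q = ∃ λ r → r ≤ p × r ≤ q

  IsResidue : V → Cond → Cond → Set₁
  IsResidue M q q̄ = proj₁ q̄ ∈ M ×
    (∀ s → proj₁ s ∈ M → s ≤ q̄ → Compatible s q)

  StronglyGeneric : V → Cond → Set₁
  StronglyGeneric M p = ∀ q → q ≤ p → ∃ λ q̄ → IsResidue M q q̄

  StronglyProperFor : V → Set₁
  StronglyProperFor M = code ∈ M ×
    (∀ s → proj₁ s ∈ M → ∃ λ p → p ≤ s × StronglyGeneric M p)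

module Forcing (ℙ : Poset) where
  open Poset ℙ

  -- `name I σ s` is the ℙ-name { (σ i , s i) : i ∈ I }.
  data Name : Set₁ where
    name : (I : Set) → (I → Name) → (I → Cond) → Name

  -- Posets are not assumed to have a top element, so every condition is attached.
  check : V → Name
  check (sup I f) =
    name (I × Ix carrier) (check ∘ f ∘ proj₁)
      λ (_ , k) → el carrier k , k , ≐-refl (el carrier k)

  DenseBelow : (Cond → Set₁) → Cond → Set₁
  DenseBelow D p = ∀ q → q ≤ p → ∃ λ r → r ≤ q × D r

  Forces≈ : Name → Name → Cond → Set₁
  Forces≈ (name I σ s) (name J τ t) p =
    (∀ i q → q ≤ p → q ≤ s i →
      DenseBelow (λ r → ∃ λ j → r ≤ t j × Forces≈ (σ i) (τ j) r) q) ×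
    (∀ j q → q ≤ p → q ≤ t j →
      DenseBelow (λ r → ∃ λ i → r ≤ s i × Forces≈ (σ i) (τ j) r) q)

  Forces∈ : Name → Name → Cond → Set₁
  Forces∈ a (name J τ t) =
    DenseBelow λ r → ∃ λ j → r ≤ t j × Forces≈ a (τ j) r

  -- The truth value of a statement of the forcing language is the predicate
  -- p ↦ "p forces the statement".
  forcing : Logic
  forcing = record
    { Dom = Name
    ; Ω   = Cond → Set₁
    ; _ε_ = Forces∈
    ; _≈_ = Forces≈
    ; ⊥′  = λ _ → Lift (lsuc 0ℓ) ⊥
    ; _∧_ = λ φ ψ p → φ p × ψ p
    ; _∨_ = λ φ ψ → DenseBelow λ r → φ r ⊎ ψ r
    ; _⊃_ = λ φ ψ p → ∀ q → q ≤ p → φ q → ψ q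
    ; All = λ φ p → ∀ σ → φ σ p
    ; Ex  = λ φ → DenseBelow λ r → ∃ λ σ → φ σ r
    }

  module InExtension = Notions forcing

LargeEnough : V → TopSpace → Poset → Set₁
LargeEnough θ 𝕏 ℙ =
  ω₂≤ θ × H θ (𝒫 X) × H θ (𝒫 carrier)
  × H θ (𝒫 (X ×ˢ carrier))  -- a subset N codes the nice name { (x̌ , p) : ⟨ x , p ⟩ ∈ N }
  × H θ (𝒫 (ω ×ˢ X))
  where
  open TopSpace 𝕏 using (X)
  open Poset ℙ using (carrier)

IsCountablyTight : TopSpace → Set₁
IsCountablyTight 𝕏 = InV.CountablyTight X λ U → Lift (lsuc 0ℓ) (U ∈ τ)
  where open TopSpace 𝕏

-- The topology generated by τ in the extension is given by its definition there
-- rather than by a name; the truth value is the same by comprehension.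
ForcesCountablyTight : Poset → TopSpace → Set₁
ForcesCountablyTight ℙ 𝕏 =
  ∀ p → InExtension.CountablyTight (check X)
          (InExtension.OpenGeneratedBy (check X) (check τ)) p
  where
  open TopSpace 𝕏
  open Forcing ℙ

{-# OPTIONS --safe #-}

-- Let q force that x lies in the closure of Ȧ.  If r is compatible with q, then
-- x lies in the closure of E(r) = { y : some s ≤ r forces y ∈ Ȧ }, so countable
-- tightness in V gives sequences (yₙ) in E(r) accumulating at x and sₙ ≤ r with
-- sₙ ⊩ yₙ ∈ Ȧ.  The countable M containing q and closed under such answers to
-- every compatible r ∈ M form a club; stationarity gives such an M for which ℙ
-- is strongly proper.  Below q take p strongly generic for M and let Ḃ = Ȧ ∩ M.
-- If r ≤ p forces W ⊆ U̇, where x ∈ W ∈ τ, the answer to a residue r̄ ∈ M of r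
-- has some yₙ ∈ W.  Since sₙ ∈ M lies below r̄, it is
-- compatible with r, and a common extension forces yₙ ∈ Ḃ ∩ U̇.
--
-- The closure of M is imposed through the club directly, which takes the place
-- of the usual appeal to elementarity.

module Submission where

open import Level using (0ℓ; Lift; lift; lower) renaming (suc to lsuc)
open import Data.Bool using (Bool; true; false; if_then_else_)
open import Data.Empty using (⊥-elim)
open import Data.Fin using (Fin; toℕ)
open import Data.Fin.Properties using (pigeonhole)
open import Data.List using (List; []; _∷_; length; lookup)
open import Data.List.Relation.Unary.Any as Any using (Any; here; there; index)
open import Data.List.Relation.Unary.Any.Properties using (lookup-index)
open import Data.Maybe using (Maybe; just; nothing)
open import Data.Nat using (ℕ; zero; suc; _+_; _≤′_; ≤′-refl; ≤′-step)
open import Data.Nat.Properties using (<-cmp; ≤⇒≤′; ≤-refl; <-irrefl; +-suc; +-identityʳ)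
open import Data.Product using (Σ; ∃; _×_; _,_; proj₁; proj₂)
open import Data.Sum using (_⊎_; inj₁; inj₂; [_,_]′; reduce)
open import Function using (_∘_)
open import Relation.Nullary using (¬_; Dec; yes; no; contradiction)
open import Relation.Nullary.Decidable using (True; toWitness; fromWitness)
open import Relation.Binary.Definitions using (tri<; tri≈; tri>)
open import Relation.Binary.PropositionalEquality using (_≡_; refl; sym; trans; subst)
open import Axiom.ExcludedMiddle using (ExcludedMiddle)
open import Defs

-- Bisimulation as equality of sets.

≐-sym : ∀ x y → x ≐ y → y ≐ x
≐-sym (sup I f) (sup J g) (F , G) =
  (λ j → let i , e = G j in i , ≐-sym (f i) (g j) e) ,
  (λ i → let j , e = F i in j , ≐-sym (f i) (g j) e)

≐-trans : ∀ x y z → x ≐ y → y ≐ z → x ≐ z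
≐-trans (sup I f) (sup J g) (sup K h) (F , G) (F′ , G′) =
  (λ i → let j , e = F i ; k , e′ = F′ j in k , ≐-trans (f i) (g j) (h k) e e′) ,
  (λ k → let j , e′ = G′ k ; i , e = G j in i , ≐-trans (f i) (g j) (h k) e e′)

el-∈ : ∀ x i → el x i ∈ x
el-∈ x i = i , ≐-refl (el x i)

∈-congˡ : ∀ x y z → x ≐ y → x ∈ z → y ∈ z
∈-congˡ x y z x≐y (i , e) = i , ≐-trans y x (el z i) (≐-sym x y x≐y) e

∈-congʳ : ∀ x y z → y ≐ z → x ∈ y → x ∈ z
∈-congʳ x (sup I f) (sup J g) (F , _) (i , e) =
  let j , e′ = F i in j , ≐-trans x (f i) (g j) e e′

⊆-antisym : ∀ x y → x ⊆ y → y ⊆ x → x ≐ y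
⊆-antisym (sup I f) (sup J g) x⊆y y⊆x =
  (λ i → x⊆y (f i) (el-∈ (sup I f) i)) ,
  (λ j → let i , e = y⊆x (g j) (el-∈ (sup J g) j) in i , ≐-sym (g j) (f i) e)

-- Well-foundedness as structural recursion: a set equal to one of its children makes that child a
-- member of itself.
∈-irrefl : ∀ x → ¬ x ∈ x
∈-irrefl (sup I f) (i , e) =
  ∈-irrefl (f i) (∈-congʳ (f i) (sup I f) (f i) e (el-∈ (sup I f) i))

-- Pairs

∈-upair⁻ : ∀ z x y → z ∈ ｛ x , y ｝ → z ≐ x ⊎ z ≐ y
∈-upair⁻ z x y (true  , e) = inj₁ e
∈-upair⁻ z x y (false , e) = inj₂ e

∈-upairˡ : ∀ x y → x ∈ ｛ x , y ｝
∈-upairˡ x y = true , ≐-refl x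

∈-upairʳ : ∀ x y → y ∈ ｛ x , y ｝
∈-upairʳ x y = false , ≐-refl y

upair-cong : ∀ x x′ y y′ → x ≐ x′ → y ≐ y′ → ｛ x , y ｝ ≐ ｛ x′ , y′ ｝
upair-cong x x′ y y′ e e′ =
  (λ { true → true , e ; false → false , e′ }) ,
  (λ { true → true , e ; false → false , e′ })

pair-cong : ∀ x x′ y y′ → x ≐ x′ → y ≐ y′ → ⟨ x , y ⟩ ≐ ⟨ x′ , y′ ⟩
pair-cong x x′ y y′ e e′ =
  upair-cong ｛ x , x ｝ ｛ x′ , x′ ｝ ｛ x , y ｝ ｛ x′ , y′ ｝
    (upair-cong x x′ x x′ e e) (upair-cong x x′ y y′ e e′)

∈-∈-pair⁻ : ∀ v u x y → u ∈ ⟨ x , y ⟩ → v ∈ u → v ≐ x ⊎ v ≐ y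
∈-∈-pair⁻ v u x y (true  , e) v∈u =
  inj₁ (reduce
    (∈-upair⁻ v x x (∈-congʳ v u ｛ x , x ｝ e v∈u)))
∈-∈-pair⁻ v u x y (false , e) v∈u = ∈-upair⁻ v x y (∈-congʳ v u ｛ x , y ｝ e v∈u)

pair-injectiveˡ : ∀ x y x′ y′ → ⟨ x , y ⟩ ≐ ⟨ x′ , y′ ⟩ → x ≐ x′
pair-injectiveˡ x y x′ y′ e
  with ∈-congʳ ｛ x′ , x′ ｝ ⟨ x′ , y′ ⟩ ⟨ x , y ⟩ (≐-sym ⟨ x , y ⟩ ⟨ x′ , y′ ⟩ e)
         (∈-upairˡ ｛ x′ , x′ ｝ ｛ x′ , y′ ｝)
... | true , e′ =
  reduce (∈-upair⁻ x x′ x′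
    (∈-congʳ x ｛ x , x ｝ ｛ x′ , x′ ｝ (≐-sym ｛ x′ , x′ ｝ ｛ x , x ｝ e′) (∈-upairˡ x x)))
... | false , e′ =
  reduce (∈-upair⁻ x x′ x′
    (∈-congʳ x ｛ x , y ｝ ｛ x′ , x′ ｝ (≐-sym ｛ x′ , x′ ｝ ｛ x , y ｝ e′) (∈-upairˡ x y)))

-- Each second coordinate belongs to a member of the other pair. The one case not settled at once is
-- `y ≐ x′` with `y′ ≐ x`, where equality of the first coordinates closes the circle.
pair-injectiveʳ : ∀ x y x′ y′ → ⟨ x , y ⟩ ≐ ⟨ x′ , y′ ⟩ → y ≐ y′
pair-injectiveʳ x y x′ y′ e
  with ∈-∈-pair⁻ y ｛ x , y ｝ x′ y′
         (∈-congʳ ｛ x , y ｝ ⟨ x , y ⟩ ⟨ x′ , y′ ⟩ e (∈-upairʳ ｛ x , x ｝ ｛ x , y ｝))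
         (∈-upairʳ x y)
... | inj₂ y≐y′ = y≐y′
... | inj₁ y≐x′
  with ∈-∈-pair⁻ y′ ｛ x′ , y′ ｝ x y
         (∈-congʳ ｛ x′ , y′ ｝ ⟨ x′ , y′ ⟩ ⟨ x , y ⟩ (≐-sym ⟨ x , y ⟩ ⟨ x′ , y′ ⟩ e)
           (∈-upairʳ ｛ x′ , x′ ｝ ｛ x′ , y′ ｝))
         (∈-upairʳ x′ y′)
... | inj₂ y′≐y = ≐-sym y′ y y′≐y
... | inj₁ y′≐x = ≐-trans y x′ y′ y≐x′
  (≐-trans x′ x y′ (≐-sym x x′ (pair-injectiveˡ x y x′ y′ e)) (≐-sym y′ x y′≐x))

-- With the three lemmas that follow, this translates between the pair formulas of `Notions` and the
-- concrete sets, so that graphs can be handled through equality with `⟨ x , y ⟩`.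
IsUnorderedPair-upair : ∀ u x y → u ≐ ｛ x , y ｝ → InV.IsUnorderedPair u x y
IsUnorderedPair-upair u x y e v =
  (λ (lift v∈u) → [ inj₁ ∘ lift , inj₂ ∘ lift ]′
    (∈-upair⁻ v x y (∈-congʳ v u ｛ x , y ｝ e v∈u))) ,
  λ { (inj₁ (lift d)) → lift (∈-congʳ v ｛ x , y ｝ u (≐-sym u ｛ x , y ｝ e) (true , d))
    ; (inj₂ (lift d)) → lift (∈-congʳ v ｛ x , y ｝ u (≐-sym u ｛ x , y ｝ e) (false , d)) }

IsUnorderedPair⇒≐ : ∀ u x y → InV.IsUnorderedPair u x y → u ≐ ｛ x , y ｝
IsUnorderedPair⇒≐ u x y h = ⊆-antisym u ｛ x , y ｝
  (λ v v∈u → [ (λ (lift d) → true , d) , (λ (lift d) → false , d) ]′ (proj₁ (h v) (lift v∈u)))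
  (λ { v (true , d)  → lower (proj₂ (h v) (inj₁ (lift d)))
     ; v (false , d) → lower (proj₂ (h v) (inj₂ (lift d))) })

IsPair-pair : ∀ z x y → z ≐ ⟨ x , y ⟩ → InV.IsPair z x y
IsPair-pair z x y e u =
  (λ (lift u∈z) →
    [ inj₁ ∘ IsUnorderedPair-upair u x x , inj₂ ∘ IsUnorderedPair-upair u x y ]′
      (∈-upair⁻ u ｛ x , x ｝ ｛ x , y ｝ (∈-congʳ u z ⟨ x , y ⟩ e u∈z))) ,
  λ { (inj₁ h) → lift (∈-congʳ u ⟨ x , y ⟩ z z≐ (true , IsUnorderedPair⇒≐ u x x h))
    ; (inj₂ h) → lift (∈-congʳ u ⟨ x , y ⟩ z z≐ (false , IsUnorderedPair⇒≐ u x y h)) }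
  where z≐ = ≐-sym z ⟨ x , y ⟩ e

IsPair⇒≐ : ∀ z x y → InV.IsPair z x y → z ≐ ⟨ x , y ⟩
IsPair⇒≐ z x y h = ⊆-antisym z ⟨ x , y ⟩
  (λ u u∈z → [ (λ d → true , IsUnorderedPair⇒≐ u x x d) , (λ d → false , IsUnorderedPair⇒≐ u x y d) ]′
    (proj₁ (h u) (lift u∈z)))
  (λ { u (true , d)  → lower (proj₂ (h u) (inj₁ (IsUnorderedPair-upair u x x d)))
     ; u (false , d) → lower (proj₂ (h u) (inj₂ (IsUnorderedPair-upair u x y d))) })

Related-cong : ∀ f x x′ y y′ → x ≐ x′ → y ≐ y′ → InV.Related f x y → InV.Related f x′ y′
Related-cong f x x′ y y′ e e′ (z , z∈f , h) =
  z , z∈f , IsPair-pair z x′ y′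
    (≐-trans z ⟨ x , y ⟩ ⟨ x′ , y′ ⟩ (IsPair⇒≐ z x y h) (pair-cong x x′ y y′ e e′))

-- Natural numbers

numeral-∈ : ∀ {m n} → suc m ≤′ n → numeral m ∈ numeral n
numeral-∈ {m} ≤′-refl     = nothing , ≐-refl (numeral m)
numeral-∈     (≤′-step h) = let j , e = numeral-∈ h in just j , e

-- For `m` and `n` distinct, one numeral is a member of the other, so equality would contradict
-- `∈-irrefl`.
numeral-injective : ∀ {m n} → numeral m ≐ numeral n → m ≡ n
numeral-injective {m} {n} e with <-cmp m n
... | tri≈ _ m≡n _ = m≡n
... | tri< m<n _ _ = ⊥-elim (∈-irrefl (numeral n)
  (∈-congˡ (numeral m) (numeral n) (numeral n) e (numeral-∈ (≤⇒≤′ m<n))))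
... | tri> _ _ n<m = ⊥-elim (∈-irrefl (numeral n)
  (∈-congʳ (numeral n) (numeral m) (numeral n) e (numeral-∈ (≤⇒≤′ n<m))))

ω-inductive : InV.Inductive ω
ω-inductive =
  (numeral 0 , lift (0 , ≐-refl (numeral 0)) , λ { x (lift (() , _)) }) ,
  λ { x (lift (n , e)) →
    numeral (suc n) , lift (suc n , ≐-refl (numeral (suc n))) , λ y →
    (λ { (lift (just j , d)) → inj₁ (lift
           (∈-congʳ y (numeral n) x (≐-sym x (numeral n) e) (j , d)))
       ; (lift (nothing , d)) → inj₂ (lift
           (≐-trans y (numeral n) x d (≐-sym x (numeral n) e))) }) ,
    λ { (inj₁ (lift d)) → let j , d′ = ∈-congʳ y x (numeral n) e d in lift (just j , d′)
      ; (inj₂ (lift d)) → lift (nothing , ≐-trans y x (numeral n) d e) } }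

-- Walks along the antidiagonals.
unpair : ℕ → ℕ × ℕ
unpair zero    = 0 , 0
unpair (suc n) with unpair n
... | i , suc j = suc i , j
... | i , zero  = 0 , suc i

-- Recursion on the diagonal `d`, then on `i`: `(suc i , j)` comes right after `(i , suc j)`, and
-- `(0 , suc d)` right after `(d , 0)`, the last point of the diagonal before.
unpair-surjective : ∀ i j → ∃ λ n → unpair n ≡ (i , j)
unpair-surjective i j = diagonal (i + j) i j refl
  where
  diagonal : ∀ d i j → i + j ≡ d → ∃ λ n → unpair n ≡ (i , j)
  diagonal d zero zero _ = 0 , refl
  diagonal (suc d) zero (suc j) refl =
    let n , e = diagonal d d zero (+-identityʳ d) in suc n , step n e
    where
    step : ∀ n → unpair n ≡ (d , zero) → unpair (suc n) ≡ (0 , suc d)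
    step n e rewrite e = refl
  diagonal d (suc i) j h =
    let n , e = diagonal d i (suc j) (trans (+-suc i j) h) in suc n , step n e
    where
    step : ∀ n → unpair n ≡ (i , suc j) → unpair (suc n) ≡ (suc i , j)
    step n e rewrite e = refl

-- Countable sets

-- Sequences of the metatheory replace set-theoretic maps to and from `ω`. Repetitions are allowed;
-- `Injective` is demanded separately.
IsEnumeration : (ℕ → V) → V → Set₁
IsEnumeration g M = (∀ n → g n ∈ M) × (∀ x → x ∈ M → ∃ λ n → x ≐ g n)

Injective : (ℕ → V) → Set
Injective g = ∀ m n → g m ≐ g n → m ≡ n

HasBijection : V → Set₁
HasBijection M = ∃ λ f → InV.IsBijection f M ω

bijection⇒enumeration : ∀ M → HasBijection M → ∃ λ g → IsEnumeration g M × Injective g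
bijection⇒enumeration M (f , ((_ , total , functional) , injective) , onto) =
  g , (g-∈ , λ x x∈M →
    let y , lift (n , e) , r = total x (lift x∈M)
    in n , lower (injective x (g n) (numeral n)
             (Related-cong f x x y (numeral n) (≐-refl x) e r) (g-related n))) ,
  λ m n e → numeral-injective (lower (functional (g n) (numeral m) (numeral n)
    (Related-cong f (g m) (g n) (numeral m) (numeral m) e (≐-refl (numeral m)) (g-related m))
    (g-related n)))
  where
  preimage : ∀ n → _
  preimage n = onto (numeral n) (lift (n , ≐-refl (numeral n)))
  g : ℕ → V
  g n = proj₁ (preimage n)
  g-∈ : ∀ n → g n ∈ M
  g-∈ n = lower (proj₁ (proj₂ (preimage n)))
  g-related : ∀ n → InV.Related f (g n) (numeral n)
  g-related n = proj₂ (proj₂ (preimage n))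

enumeration⇒bijection : ∀ g M → IsEnumeration g M → Injective g → HasBijection M
enumeration⇒bijection g M (g-∈ , g-onto) g-inj =
  f ,
  (((λ { z (lift (n , e)) →
       g n , lift (g-∈ n) , numeral n , lift (∈ω n) , IsPair-pair z (g n) (numeral n) e })
   , (λ x (lift x∈M) → let n , e = g-onto x x∈M in
       numeral n , lift (∈ω n) , f-intro x n e)
   , (λ x y y′ r r′ → lift (functional x y y′ (f-elim x y r) (f-elim x y′ r′))))
  , (λ x x′ y r r′ → lift (injective x x′ y (f-elim x y r) (f-elim x′ y r′))))
  , λ { y (lift (n , e)) → g n , lift (g-∈ n) ,
        Related-cong f (g n) (g n) (numeral n) y (≐-refl (g n)) (≐-sym y (numeral n) e)
          (f-intro (g n) n (≐-refl (g n))) }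
  where
  f = sup ℕ λ n → ⟨ g n , numeral n ⟩
  ∈ω : ∀ n → numeral n ∈ ω
  ∈ω n = n , ≐-refl (numeral n)
  f-intro : ∀ x n → x ≐ g n → InV.Related f x (numeral n)
  f-intro x n e = ⟨ g n , numeral n ⟩ , lift (n , ≐-refl ⟨ g n , numeral n ⟩) ,
    IsPair-pair ⟨ g n , numeral n ⟩ x (numeral n)
      (pair-cong (g n) x (numeral n) (numeral n) (≐-sym x (g n) e) (≐-refl (numeral n)))
  f-elim : ∀ x y → InV.Related f x y → ∃ λ n → x ≐ g n × y ≐ numeral n
  f-elim x y (z , lift (n , e) , h) =
    n , pair-injectiveˡ x y (g n) (numeral n) z≐ , pair-injectiveʳ x y (g n) (numeral n) z≐
    where z≐ = ≐-trans ⟨ x , y ⟩ z ⟨ g n , numeral n ⟩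
                 (≐-sym z ⟨ x , y ⟩ (IsPair⇒≐ z x y h)) e
  functional : ∀ x y y′ → (∃ λ n → x ≐ g n × y ≐ numeral n) →
               (∃ λ n → x ≐ g n × y′ ≐ numeral n) → y ≐ y′
  functional x y y′ (m , e , d) (n , e′ , d′)
    with refl ← g-inj m n (≐-trans (g m) x (g n) (≐-sym x (g m) e) e′)
    = ≐-trans y (numeral m) y′ d (≐-sym y′ (numeral m) d′)
  injective : ∀ x x′ y → (∃ λ n → x ≐ g n × y ≐ numeral n) →
              (∃ λ n → x′ ≐ g n × y ≐ numeral n) → x ≐ x′
  injective x x′ y (m , e , d) (n , e′ , d′)
    with refl ← numeral-injective {m} {n}
                  (≐-trans (numeral m) y (numeral n) (≐-sym y (numeral m) d) d′)
    = ≐-trans x (g m) x′ e (≐-sym x′ (g m) e′)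

-- `IsFunction` requires every member of a graph to be a pair from domain and codomain, so the graph
-- has to be cut down to `a ×ˢ c`.
≼-⊆ : ∀ a b c → a ⊆ b → b InV.≼ c → a InV.≼ c
≼-⊆ a b c a⊆b (f , (_ , total , functional) , injective) =
  f′ ,
  (typed
  , (λ x (lift x∈a) →
      let y , lift (j , d) , z , lift (k , e) , h = total x (lift (a⊆b x x∈a))
          i , d′ = x∈a
          z≐ = IsPair⇒≐ z x y h
      in y , lift (j , d) , z ,
         lift ((k , (i , j) ,
                ≐-trans (el f k) z ⟨ el a i , el c j ⟩ (≐-sym z (el f k) e)
                  (≐-trans z ⟨ x , y ⟩ ⟨ el a i , el c j ⟩ z≐
                    (pair-cong x (el a i) y (el c j) d′ d))) , e) ,
         h)
  , λ x y y′ r r′ → functional x y y′ (weaken x y r) (weaken x y′ r′)) ,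
  λ x x′ y r r′ → injective x x′ y (weaken x y r) (weaken x′ y r′)
  where
  f′ = f ∩ (a ×ˢ c)
  typed : ∀ z → Lift _ (z ∈ f′) → _
  typed z (lift ((k , (i , j) , d) , e)) =
    el a i , lift (el-∈ a i) , el c j , lift (el-∈ c j) ,
    IsPair-pair z (el a i) (el c j) (≐-trans z (el f k) ⟨ el a i , el c j ⟩ e d)
  weaken : ∀ x y → InV.Related f′ x y → InV.Related f x y
  weaken x y (z , lift ((i , _) , e) , h) = z , lift (i , e) , h

-- Transitive closures and H(θ).

trcl-cong : ∀ x y → x ≐ y → trcl x ⊆ trcl y
trcl-cong (sup I f) (sup J g) (F , _) z ((i , nothing) , e) =
  let j , e′ = F i in (j , nothing) , ≐-trans z (f i) (g j) e e′
trcl-cong (sup I f) (sup J g) (F , _) z ((i , just k) , e) =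
  let j , e′ = F i ; k′ , e″ = trcl-cong (f i) (g j) e′ z (k , e) in (j , just k′) , e″

trcl-∈ : ∀ x y → x ∈ y → trcl x ⊆ trcl y
trcl-∈ x (sup J g) (j , e) z z∈ =
  let k , e′ = trcl-cong x (g j) e z z∈ in (j , just k) , e′

H-transitive : ∀ θ x y → x ∈ y → H θ y → H θ x
H-transitive θ x y x∈y (α , α∈θ , y≼α) =
  α , α∈θ , ≼-⊆ (trcl x) (trcl y) α (trcl-∈ x y x∈y) y≼α

-- Extracts `X` and the carrier of the poset from the codes that are assumed to lie in `H θ`.
first-∈H : ∀ θ a b → H θ ⟨ a , b ⟩ → H θ a
first-∈H θ a b h = H-transitive θ a ｛ a , a ｝ (∈-upairˡ a a)
  (H-transitive θ ｛ a , a ｝ ⟨ a , b ⟩ (∈-upairˡ ｛ a , a ｝ ｛ a , b ｝) h)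

-- Separation and countability by excluded middle.

module Classical (em : ExcludedMiddle (lsuc 0ℓ)) where

  -- Excluded middle decides the `Set₁`-valued predicate, and `True` of the decision is small enough
  -- to index a set.
  separate : (x : V) → (Ix x → Set₁) → V
  separate x P = sup (Σ (Ix x) λ i → True (em {P i})) (el x ∘ proj₁)

  -- Inverts the injection, with `b` as the default at numbers outside its range. The witness `w`
  -- for the natural numbers is contained in `ω`, because `ω` is inductive, so every value of the
  -- injection is a numeral.
  countable⇒enumeration : ∀ b B → b ∈ B → InV.Countable B → ∃ λ g → IsEnumeration g B
  countable⇒enumeration b B b∈B (w , (_ , least) , f , (_ , total , _) , injective) =
    g , g-∈ , λ x x∈B →
      let y , y∈w , r = total x (lift x∈B)
          n , e = lower (least ω ω-inductive y y∈w)
      in n , onto x y n x∈B e r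
    where
    Preimage : ℕ → Set₁
    Preimage n = ∃ λ x → ∃ λ y → x ∈ B × y ≐ numeral n × InV.Related f x y
    choose : ∀ n → Dec (Preimage n) → V
    choose n (yes (x , _)) = x
    choose n (no _)        = b
    g : ℕ → V
    g n = choose n em
    g-∈ : ∀ n → g n ∈ B
    g-∈ n with em {Preimage n}
    ... | yes (_ , _ , x∈B , _) = x∈B
    ... | no _                  = b∈B
    onto : ∀ x y n → x ∈ B → y ≐ numeral n → InV.Related f x y → x ≐ g n
    onto x y n x∈B e r with em {Preimage n}
    ... | no ¬p = contradiction (x , y , x∈B , e , r) ¬p
    ... | yes (x′ , y′ , _ , e′ , r′) = lower (injective x x′ y r
      (Related-cong f x′ x′ y′ y (≐-refl x′)
        (≐-trans y′ (numeral n) y e′ (≐-sym y (numeral n) e)) r′))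

  _∈ᴸ_ : V → List V → Set₁
  x ∈ᴸ l = Any (x ≐_) l

  -- Otherwise the first `suc (length l)` values all have positions in `l`; by the pigeonhole
  -- principle two of them share a position and are equal.
  injective⇒fresh : ∀ h → Injective h → ∀ l → ∃ λ n → ¬ h n ∈ᴸ l
  injective⇒fresh h h-inj l with em {∃ λ n → ¬ h n ∈ᴸ l}
  ... | yes (n , h∉) = n , h∉
  ... | no ¬fresh =
    let i , j , i<j , e = pigeonhole ≤-refl (λ i → index (all i))
    in contradiction i<j (<-irrefl (h-inj (toℕ i) (toℕ j) (collide i j e)))
    where
    all : (i : Fin (suc (length l))) → h (toℕ i) ∈ᴸ l
    all i with em {h (toℕ i) ∈ᴸ l}
    ... | yes p = p
    ... | no ¬p = contradiction (toℕ i , ¬p) ¬fresh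
    collide : ∀ i j → index (all i) ≡ index (all j) → h (toℕ i) ≐ h (toℕ j)
    collide i j e = ≐-trans (h (toℕ i)) v (h (toℕ j)) (lookup-index (all i))
      (≐-sym (h (toℕ j)) v (subst (λ k → h (toℕ j) ≐ lookup l k) (sym e) (lookup-index (all j))))
      where v = lookup l (index (all i))

  -- The n-th value is e n unless that repeats an earlier value, in which case it
  -- is some unused value of h; so e n occurs among the first n + 1 values.
  injectiveEnumeration : ∀ M e h → IsEnumeration e M → (∀ n → h n ∈ M) → Injective h →
                         ∃ λ g → IsEnumeration g M × Injective g
  injectiveEnumeration M e h (e-∈ , e-onto) h-∈ h-inj =
    g , (g-∈ , λ x x∈M →
      let n , x≐ = e-onto x x∈M ; m , d = hit (suc n) (caught n)
      in m , ≐-trans x (e n) (g m) x≐ d) ,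
    λ m n d → injective m n d
    where
    next : (n : ℕ) (l : List V) → Dec (e n ∈ᴸ l) → V
    next n l (yes _) = h (proj₁ (injective⇒fresh h h-inj l))
    next n l (no _)  = e n
    history : ℕ → List V
    g : ℕ → V
    history zero    = []
    history (suc n) = g n ∷ history n
    g n = next n (history n) em
    g-∈ : ∀ n → g n ∈ M
    g-∈ n with em {e n ∈ᴸ history n}
    ... | yes _ = h-∈ _
    ... | no _  = e-∈ n
    g-fresh : ∀ n → ¬ g n ∈ᴸ history n
    g-fresh n with em {e n ∈ᴸ history n}
    ... | yes _ = proj₂ (injective⇒fresh h h-inj (history n))
    ... | no ¬p = ¬p
    caught : ∀ n → e n ∈ᴸ history (suc n)
    caught n with em {e n ∈ᴸ history n}
    ... | yes p = there p
    ... | no _         = here (≐-refl (e n))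
    hit : ∀ {x} n → x ∈ᴸ history n → ∃ λ m → x ≐ g m
    hit (suc n) (here d)  = n , d
    hit (suc n) (there p) = hit n p
    remember : ∀ {m n} → suc m ≤′ n → g m ∈ᴸ history n
    remember {m} ≤′-refl     = here (≐-refl (g m))
    remember     (≤′-step p) = there (remember p)
    transfer : ∀ {x y l} → x ≐ y → x ∈ᴸ l → y ∈ᴸ l
    transfer {x} {y} d = Any.map λ {v} → ≐-trans y x v (≐-sym x y d)
    injective : Injective g
    injective m n d with <-cmp m n
    ... | tri≈ _ m≡n _ = m≡n
    ... | tri< m<n _ _ = contradiction (transfer d (remember (≤⇒≤′ m<n))) (g-fresh n)
    ... | tri> _ _ n<m =
      contradiction (transfer (≐-sym (g m) (g n) d) (remember (≤⇒≤′ n<m))) (g-fresh m)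

-- The forcing relation

module ForcingProperties (ℙ : Poset) where
  open Poset ℙ
  open Forcing ℙ
  module Ext = InExtension

  ≤-congˡ : ∀ p q r → proj₁ p ≐ proj₁ q → p ≤ r → q ≤ r
  ≤-congˡ (x , _) (y , _) (z , _) e =
    ∈-congˡ ⟨ x , z ⟩ ⟨ y , z ⟩ order (pair-cong x y z z e (≐-refl z))

  ≤-congʳ : ∀ p q r → proj₁ q ≐ proj₁ r → p ≤ q → p ≤ r
  ≤-congʳ (x , _) (y , _) (z , _) e =
    ∈-congˡ ⟨ x , y ⟩ ⟨ x , z ⟩ order (pair-cong x x y z (≐-refl x) e)

  -- `Cond` lies in `Set₁` and is too large to index a `name`. Atoms are conditions indexed by a
  -- small type, and by `toAtom` each condition is equivalent to one of them.
  atom : Ix carrier → Cond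
  atom k = el carrier k , el-∈ carrier k

  toAtom : ∀ p → ∃ λ k → p ≤ atom k × atom k ≤ p
  toAtom p@(x , k , e) =
    k , ≤-congʳ p p (atom k) e (reflexive p) , ≤-congˡ p (atom k) p e (reflexive p)

  DenseBelow-mono : ∀ {D} p q → q ≤ p → DenseBelow D p → DenseBelow D q
  DenseBelow-mono p q q≤p h r r≤q = h r (transitive r q p r≤q q≤p)

  DenseBelow-bind : ∀ {D E} p → DenseBelow D p →
                    (∀ r → r ≤ p → D r → DenseBelow E r) → DenseBelow E p
  DenseBelow-bind p h f q q≤p =
    let r , r≤q , d = h q q≤p
        s , s≤r , e = f r (transitive r q p r≤q q≤p) d r (reflexive r)
    in s , transitive s r q s≤r r≤q , e

  DenseBelow-map : ∀ {D E} p → DenseBelow D p →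
                   (∀ r → r ≤ p → D r → E r) → DenseBelow E p
  DenseBelow-map p h f q q≤p =
    let r , r≤q , d = h q q≤p in r , r≤q , f r (transitive r q p r≤q q≤p) d

  ≈-refl : ∀ a p → Forces≈ a a p
  ≈-refl (name I σ s) p =
    (λ i q _ q≤s r r≤q → r , reflexive r , i , transitive r q (s i) r≤q q≤s , ≈-refl (σ i) r) ,
    (λ i q _ q≤s r r≤q → r , reflexive r , i , transitive r q (s i) r≤q q≤s , ≈-refl (σ i) r)

  ≈-sym : ∀ a b p → Forces≈ a b p → Forces≈ b a p
  ≈-sym (name I σ s) (name J τ t) p (F , G) =
    (λ j q q≤p q≤t r r≤q →
      let r′ , r′≤r , i , r′≤s , e = G j q q≤p q≤t r r≤q
      in r′ , r′≤r , i , r′≤s , ≈-sym (σ i) (τ j) r′ e) ,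
    (λ i q q≤p q≤s r r≤q →
      let r′ , r′≤r , j , r′≤t , e = F i q q≤p q≤s r r≤q
      in r′ , r′≤r , j , r′≤t , ≈-sym (σ i) (τ j) r′ e)

  ≈-mono : ∀ a b p q → q ≤ p → Forces≈ a b p → Forces≈ a b q
  ≈-mono (name I σ s) (name J τ t) p q q≤p (F , G) =
    (λ i r r≤q → F i r (transitive r q p r≤q q≤p)) ,
    (λ j r r≤q → G j r (transitive r q p r≤q q≤p))

  -- Both clauses of `Forces≈` end in a density statement, which absorbs the outer one. This permits
  -- proving an equality after passing to stronger conditions.
  ≈-local : ∀ a b p → DenseBelow (Forces≈ a b) p → Forces≈ a b p
  ≈-local (name I σ s) (name J τ t) p h =
    (λ i q q≤p q≤s → DenseBelow-bind q (DenseBelow-mono p q q≤p h) λ r r≤q (F , _) →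
      F i r (reflexive r) (transitive r q (s i) r≤q q≤s)) ,
    (λ j q q≤p q≤t → DenseBelow-bind q (DenseBelow-mono p q q≤p h) λ r r≤q (_ , G) →
      G j r (reflexive r) (transitive r q (t j) r≤q q≤t))

  ≈-trans : ∀ a b c p → Forces≈ a b p → Forces≈ b c p → Forces≈ a c p
  ≈-trans (name I σ s) (name J τ t) (name K υ u) p (F , G) (F′ , G′) =
    (λ i q q≤p q≤s r r≤q →
      let r₁ , r₁≤r , j , r₁≤t , e = F i q q≤p q≤s r r≤q
          r₁≤p = transitive r₁ r p r₁≤r (transitive r q p r≤q q≤p)
          r₂ , r₂≤r₁ , k , r₂≤u , e′ = F′ j r₁ r₁≤p r₁≤t r₁ (reflexive r₁)
      in r₂ , transitive r₂ r₁ r r₂≤r₁ r₁≤r , k , r₂≤u ,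
         ≈-trans (σ i) (τ j) (υ k) r₂ (≈-mono (σ i) (τ j) r₁ r₂ r₂≤r₁ e) e′) ,
    (λ k q q≤p q≤u r r≤q →
      let r₁ , r₁≤r , j , r₁≤t , e′ = G′ k q q≤p q≤u r r≤q
          r₁≤p = transitive r₁ r p r₁≤r (transitive r q p r≤q q≤p)
          r₂ , r₂≤r₁ , i , r₂≤s , e = G j r₁ r₁≤p r₁≤t r₁ (reflexive r₁)
      in r₂ , transitive r₂ r₁ r r₂≤r₁ r₁≤r , i , r₂≤s ,
         ≈-trans (σ i) (τ j) (υ k) r₂ e (≈-mono (τ j) (υ k) r₁ r₂ r₂≤r₁ e′))

  ε-mono : ∀ a b p q → q ≤ p → Forces∈ a b p → Forces∈ a b q
  ε-mono a (name J τ t) p q q≤p h = DenseBelow-mono p q q≤p h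

  ε-local : ∀ a b p → DenseBelow (Forces∈ a b) p → Forces∈ a b p
  ε-local a (name J τ t) p h = DenseBelow-bind p h λ _ _ d → d

  ε-congˡ : ∀ a b c p → Forces≈ a b p → Forces∈ a c p → Forces∈ b c p
  ε-congˡ a b (name K υ u) p e h = DenseBelow-map p h λ r r≤p (k , r≤u , d) →
    k , r≤u , ≈-trans b a (υ k) r (≈-sym a b r (≈-mono a b p r r≤p e)) d

  ε-congʳ : ∀ a b c p → Forces≈ b c p → Forces∈ a b p → Forces∈ a c p
  ε-congʳ a (name J τ t) (name K υ u) p (F , _) h =
    DenseBelow-bind p h λ r r≤p (j , r≤t , d) →
    DenseBelow-map r (F j r r≤p r≤t) λ r′ r′≤r (k , r′≤u , e) →
    k , r′≤u , ≈-trans a (τ j) (υ k) r′ (≈-mono a (τ j) r r′ r′≤r d) e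

  -- `Forces≈` tests only the constituents `σ i` and `τ j`, and each is forced into its name by
  -- every condition below the attached one.
  ≈-ext : ∀ a b p → (∀ x q → q ≤ p → Forces∈ x a q → Forces∈ x b q) →
          (∀ x q → q ≤ p → Forces∈ x b q → Forces∈ x a q) → Forces≈ a b p
  ≈-ext (name I σ s) (name J τ t) p a⊆b b⊆a =
    (λ i q q≤p q≤s → a⊆b (σ i) q q≤p λ r r≤q →
      r , reflexive r , i , transitive r q (s i) r≤q q≤s , ≈-refl (σ i) r) ,
    (λ j q q≤p q≤t → DenseBelow-map q
      (b⊆a (τ j) q q≤p λ r r≤q →
        r , reflexive r , j , transitive r q (t j) r≤q q≤t , ≈-refl (τ j) r)
      λ r _ (i , r≤s , e) → i , r≤s , ≈-sym (τ j) (σ i) r e)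

  check-cong : ∀ x y p → x ≐ y → Forces≈ (check x) (check y) p
  check-cong (sup I f) (sup J g) p (F , G) =
    (λ (i , k) q _ q≤k r r≤q → let j , e = F i in
      r , reflexive r , (j , k) , transitive r q (atom k) r≤q q≤k ,
      check-cong (f i) (g j) r e) ,
    (λ (j , k) q _ q≤k r r≤q → let i , e = G j in
      r , reflexive r , (i , k) , transitive r q (atom k) r≤q q≤k ,
      check-cong (f i) (g j) r e)

  -- Every member of a checked set is attached to an atom above `p`. The recursion may continue at
  -- whatever condition the match provides, since the conclusion does not mention conditions.
  check-injective : ∀ x y p → Forces≈ (check x) (check y) p → x ≐ y
  check-injective (sup I f) (sup J g) p (F , G) =
    (λ i → let k , p≤k , _ = toAtom p
               r , _ , (j , _) , _ , e = F (i , k) p (reflexive p) p≤k p (reflexive p)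
           in j , check-injective (f i) (g j) r e) ,
    (λ j → let k , p≤k , _ = toAtom p
               r , _ , (i , _) , _ , e = G (j , k) p (reflexive p) p≤k p (reflexive p)
           in i , check-injective (f i) (g j) r e)

  ε-check⁻ : ∀ a x p → Forces∈ a (check x) p →
             DenseBelow (λ r → ∃ λ i → Forces≈ a (check (el x i)) r) p
  ε-check⁻ a (sup I f) p h = DenseBelow-map p h λ _ _ ((i , _) , _ , e) → i , e

  ε-check⁺ : ∀ a x y p → x ∈ y → Forces≈ a (check x) p → Forces∈ a (check y) p
  ε-check⁺ a x (sup J g) p (j , e) d q q≤p =
    let k , q≤k , _ = toAtom q
    in q , reflexive q , (j , k) , q≤k ,
       ≈-trans a (check x) (check (g j)) q (≈-mono a (check x) p q q≤p d) (check-cong x (g j) q e)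

  check-∈ : ∀ x y p → x ∈ y → Forces∈ (check x) (check y) p
  check-∈ x y p x∈y = ε-check⁺ (check x) x y p x∈y (≈-refl (check x) p)

  check-∈⁻ : ∀ x y p → Forces∈ (check x) (check y) p → x ∈ y
  check-∈⁻ x y p h =
    let r , _ , i , e = ε-check⁻ (check x) y p h p (reflexive p)
    in i , check-injective x (el y i) r e

  check-⊑ : ∀ x y p → x ⊆ y → (check x Ext.⊑ check y) p
  check-⊑ x y p x⊆y a q _ h = ε-local a (check y) q
    (DenseBelow-map q (ε-check⁻ a x q h) λ r _ (i , e) →
      ε-check⁺ a (el x i) y r (x⊆y (el x i) (el-∈ x i)) e)

  -- Pairs in the extension

  -- As in `check`, every condition is attached in place of a top element.
  upairᴺ : Name → Name → Name
  upairᴺ a b = name (Bool × Ix carrier) (λ (i , _) → if i then a else b) (atom ∘ proj₂)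

  pairᴺ : Name → Name → Name
  pairᴺ a b = upairᴺ (upairᴺ a a) (upairᴺ a b)

  ε-upair⁻ : ∀ x a b p → Forces∈ x (upairᴺ a b) p →
             DenseBelow (λ r → Forces≈ x a r ⊎ Forces≈ x b r) p
  ε-upair⁻ x a b p h = DenseBelow-map p h λ
    { _ _ ((true , _) , _ , e)  → inj₁ e
    ; _ _ ((false , _) , _ , e) → inj₂ e }

  ε-upair⁺ : ∀ x a b p → DenseBelow (λ r → Forces≈ x a r ⊎ Forces≈ x b r) p →
             Forces∈ x (upairᴺ a b) p
  ε-upair⁺ x a b p h = DenseBelow-map p h λ
    { r _ (inj₁ e) → let k , r≤k , _ = toAtom r in (true , k) , r≤k , e
    ; r _ (inj₂ e) → let k , r≤k , _ = toAtom r in (false , k) , r≤k , e }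

  ε-upairˡ : ∀ a b p → Forces∈ a (upairᴺ a b) p
  ε-upairˡ a b p = ε-upair⁺ a a b p λ q _ → q , reflexive q , inj₁ (≈-refl a q)

  ε-upairʳ : ∀ a b p → Forces∈ b (upairᴺ a b) p
  ε-upairʳ a b p = ε-upair⁺ b a b p λ q _ → q , reflexive q , inj₂ (≈-refl b q)

  ε-singleton⁻ : ∀ x a p → Forces∈ x (upairᴺ a a) p → Forces≈ x a p
  ε-singleton⁻ x a p h =
    ≈-local x a p (DenseBelow-map p (ε-upair⁻ x a a p h) λ _ _ → reduce)

  upair-⊑ : ∀ a a′ b b′ p → Forces≈ a a′ p → Forces≈ b b′ p →
            ∀ x q → q ≤ p → Forces∈ x (upairᴺ a b) q → Forces∈ x (upairᴺ a′ b′) q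
  upair-⊑ a a′ b b′ p e e′ x q q≤p h = ε-upair⁺ x a′ b′ q
    (DenseBelow-map q (ε-upair⁻ x a b q h) λ r r≤q →
      [ (λ d → inj₁ (≈-trans x a a′ r d (≈-mono a a′ p r (transitive r q p r≤q q≤p) e)))
      , (λ d → inj₂ (≈-trans x b b′ r d (≈-mono b b′ p r (transitive r q p r≤q q≤p) e′))) ]′)

  upairᴺ-cong : ∀ a a′ b b′ p → Forces≈ a a′ p → Forces≈ b b′ p →
                Forces≈ (upairᴺ a b) (upairᴺ a′ b′) p
  upairᴺ-cong a a′ b b′ p e e′ = ≈-ext (upairᴺ a b) (upairᴺ a′ b′) p
    (upair-⊑ a a′ b b′ p e e′)
    (upair-⊑ a′ a b′ b p (≈-sym a a′ p e) (≈-sym b b′ p e′))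

  pairᴺ-cong : ∀ a a′ b b′ p → Forces≈ a a′ p → Forces≈ b b′ p →
               Forces≈ (pairᴺ a b) (pairᴺ a′ b′) p
  pairᴺ-cong a a′ b b′ p e e′ =
    upairᴺ-cong (upairᴺ a a) (upairᴺ a′ a′) (upairᴺ a b) (upairᴺ a′ b′) p
      (upairᴺ-cong a a′ a a′ p e e) (upairᴺ-cong a a′ b b′ p e e′)

  -- With the three lemmas that follow, this reduces the pair formulas read in `forcing` to forced
  -- equality with the names `upairᴺ a b` and `pairᴺ a b`.
  IsUnorderedPair⁺ : ∀ u a b p → Forces≈ u (upairᴺ a b) p → Ext.IsUnorderedPair u a b p
  IsUnorderedPair⁺ u a b p e v =
    (λ q q≤p h → ε-upair⁻ v a b q (ε-congʳ v u (upairᴺ a b) q (≈-mono u (upairᴺ a b) p q q≤p e) h)) ,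
    (λ q q≤p h → ε-congʳ v (upairᴺ a b) u q
      (≈-sym u (upairᴺ a b) q (≈-mono u (upairᴺ a b) p q q≤p e)) (ε-upair⁺ v a b q h))

  IsUnorderedPair⁻ : ∀ u a b p → Ext.IsUnorderedPair u a b p → Forces≈ u (upairᴺ a b) p
  IsUnorderedPair⁻ u a b p h = ≈-ext u (upairᴺ a b) p
    (λ x q q≤p d → ε-upair⁺ x a b q (proj₁ (h x) q q≤p d))
    (λ x q q≤p d → proj₂ (h x) q q≤p (ε-upair⁻ x a b q d))

  IsPair⁺ : ∀ z a b p → Forces≈ z (pairᴺ a b) p → Ext.IsPair z a b p
  IsPair⁺ z a b p e u =
    (λ q q≤p h → DenseBelow-map q
      (ε-upair⁻ u (upairᴺ a a) (upairᴺ a b) q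
        (ε-congʳ u z (pairᴺ a b) q (≈-mono z (pairᴺ a b) p q q≤p e) h))
      λ r _ → [ inj₁ ∘ IsUnorderedPair⁺ u a a r , inj₂ ∘ IsUnorderedPair⁺ u a b r ]′) ,
    (λ q q≤p h → ε-congʳ u (pairᴺ a b) z q
      (≈-sym z (pairᴺ a b) q (≈-mono z (pairᴺ a b) p q q≤p e))
      (ε-upair⁺ u (upairᴺ a a) (upairᴺ a b) q
        (DenseBelow-map q h λ r _ →
          [ inj₁ ∘ IsUnorderedPair⁻ u a a r , inj₂ ∘ IsUnorderedPair⁻ u a b r ]′)))

  IsPair⁻ : ∀ z a b p → Ext.IsPair z a b p → Forces≈ z (pairᴺ a b) p
  IsPair⁻ z a b p h = ≈-ext z (pairᴺ a b) p
    (λ u q q≤p d → ε-upair⁺ u (upairᴺ a a) (upairᴺ a b) q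
      (DenseBelow-map q (proj₁ (h u) q q≤p d) λ r _ →
        [ inj₁ ∘ IsUnorderedPair⁻ u a a r , inj₂ ∘ IsUnorderedPair⁻ u a b r ]′))
    (λ u q q≤p d → proj₂ (h u) q q≤p
      (DenseBelow-map q (ε-upair⁻ u (upairᴺ a a) (upairᴺ a b) q d) λ r _ →
        [ inj₁ ∘ IsUnorderedPair⁺ u a a r , inj₂ ∘ IsUnorderedPair⁺ u a b r ]′))

  ε-ε-pair⁻ : ∀ v u a b p → Forces∈ u (pairᴺ a b) p → Forces∈ v u p →
              DenseBelow (λ r → Forces≈ v a r ⊎ Forces≈ v b r) p
  ε-ε-pair⁻ v u a b p h d =
    DenseBelow-bind p (ε-upair⁻ u (upairᴺ a a) (upairᴺ a b) p h) λ r r≤p →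
      [ (λ e → λ q q≤r → q , reflexive q ,
          inj₁ (≈-mono v a r q q≤r (ε-singleton⁻ v a r
            (ε-congʳ v u (upairᴺ a a) r e (ε-mono v u p r r≤p d)))))
      , (λ e → ε-upair⁻ v a b r (ε-congʳ v u (upairᴺ a b) r e (ε-mono v u p r r≤p d))) ]′

  pairᴺ-injectiveˡ : ∀ a b a′ b′ p → Forces≈ (pairᴺ a b) (pairᴺ a′ b′) p → Forces≈ a a′ p
  pairᴺ-injectiveˡ a b a′ b′ p e = ≈-local a a′ p
    (DenseBelow-map p (ε-upair⁻ ｛a′｝ (upairᴺ a a) (upairᴺ a b) p
      (ε-congʳ ｛a′｝ (pairᴺ a′ b′) (pairᴺ a b) p (≈-sym (pairᴺ a b) (pairᴺ a′ b′) p e)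
        (ε-upairˡ ｛a′｝ (upairᴺ a′ b′) p)))
      λ r _ →
        [ (λ d → ε-singleton⁻ a a′ r (ε-congʳ a (upairᴺ a a) ｛a′｝ r
            (≈-sym ｛a′｝ (upairᴺ a a) r d) (ε-upairˡ a a r)))
        , (λ d → ε-singleton⁻ a a′ r (ε-congʳ a (upairᴺ a b) ｛a′｝ r
            (≈-sym ｛a′｝ (upairᴺ a b) r d) (ε-upairˡ a b r))) ]′)
    where ｛a′｝ = upairᴺ a′ a′

  -- The argument of `pair-injectiveʳ`, with each case distinction made on a dense set and the cases
  -- reassembled by `≈-local`.
  pairᴺ-injectiveʳ : ∀ a b a′ b′ p → Forces≈ (pairᴺ a b) (pairᴺ a′ b′) p → Forces≈ b b′ p
  pairᴺ-injectiveʳ a b a′ b′ p e = ≈-local b b′ p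
    (DenseBelow-bind p (second a b a′ b′ p e) λ r r≤p →
      [ (λ b≈a′ → DenseBelow-map r
          (second a′ b′ a b r (≈-sym z z′ r (≈-mono z z′ p r r≤p e))) λ q q≤r →
          [ (λ b′≈a → ≈-trans b a′ b′ q (≈-mono b a′ r q q≤r b≈a′)
              (≈-trans a′ a b′ q
                (≈-sym a a′ q (pairᴺ-injectiveˡ a b a′ b′ q
                  (≈-mono z z′ p q (transitive q r p q≤r r≤p) e)))
                (≈-sym b′ a q b′≈a)))
          , ≈-sym b′ b q ]′)
      , (λ b≈b′ q q≤r → q , reflexive q , ≈-mono b b′ r q q≤r b≈b′) ]′)
    where
    z = pairᴺ a b
    z′ = pairᴺ a′ b′
    second : ∀ a b a′ b′ p → Forces≈ (pairᴺ a b) (pairᴺ a′ b′) p →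
             DenseBelow (λ r → Forces≈ b a′ r ⊎ Forces≈ b b′ r) p
    second a b a′ b′ p e = ε-ε-pair⁻ b (upairᴺ a b) a′ b′ p
      (ε-congʳ (upairᴺ a b) (pairᴺ a b) (pairᴺ a′ b′) p e (ε-upairʳ (upairᴺ a a) (upairᴺ a b) p))
      (ε-upairʳ a b p)

  -- ω in the extension

  ε-numeral-suc⁻ : ∀ x n p → Forces∈ x (check (numeral (suc n))) p →
    DenseBelow (λ r → Forces∈ x (check (numeral n)) r ⊎ Forces≈ x (check (numeral n)) r) p
  ε-numeral-suc⁻ x n p h = DenseBelow-map p (ε-check⁻ x (numeral (suc n)) p h) λ
    { r _ (just j , e)  → inj₁ (ε-check⁺ x (el (numeral n) j) (numeral n) r (el-∈ (numeral n) j) e)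
    ; r _ (nothing , e) → inj₂ e }

  ε-numeral-suc⁺ : ∀ x n p →
    DenseBelow (λ r → Forces∈ x (check (numeral n)) r ⊎ Forces≈ x (check (numeral n)) r) p →
    Forces∈ x (check (numeral (suc n))) p
  ε-numeral-suc⁺ x n p h = ε-local x (check (numeral (suc n))) p (DenseBelow-map p h λ
    { r _ (inj₁ d) → check-⊑ (numeral n) (numeral (suc n)) r (λ _ (j , e) → just j , e)
                       x r (reflexive r) d
    ; r _ (inj₂ e) → ε-check⁺ x (numeral n) (numeral (suc n)) r (nothing , ≐-refl (numeral n)) e })

  ¬ε-numeral-zero : ∀ x p → ¬ Forces∈ x (check (numeral 0)) p
  ¬ε-numeral-zero x p h with h p (reflexive p)
  ... | _ , _ , (() , _) , _

  check-numeral-ε-ω : ∀ n p → Forces∈ (check (numeral n)) (check ω) p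
  check-numeral-ε-ω n p = check-∈ (numeral n) ω p (el-∈ ω n)

  check-ω-inductive : ∀ p → Ext.Inductive (check ω) p
  check-ω-inductive p =
    (λ q _ → q , reflexive q , check (numeral 0) , check-numeral-ε-ω 0 q ,
      λ x r _ h → lift (¬ε-numeral-zero x r h)) ,
    λ x q _ h → DenseBelow-map q (ε-check⁻ x ω q h) λ r _ (n , e) →
      check (numeral (suc n)) , check-numeral-ε-ω (suc n) r , λ y →
      (λ s s≤r d → DenseBelow-map s (ε-numeral-suc⁻ y n s d) λ t t≤s →
        let n≈x = ≈-sym x (check (numeral n)) t
                    (≈-mono x (check (numeral n)) r t (transitive t s r t≤s s≤r) e)
        in [ (λ c → inj₁ (ε-congʳ y (check (numeral n)) x t n≈x c))
           , (λ c → inj₂ (≈-trans y (check (numeral n)) x t c n≈x)) ]′) ,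
      (λ s s≤r d → ε-numeral-suc⁺ y n s (DenseBelow-map s d λ t t≤s →
        let x≈n = ≈-mono x (check (numeral n)) r t (transitive t s r t≤s s≤r) e
        in [ (λ c → inj₁ (ε-congʳ y x (check (numeral n)) t x≈n c))
           , (λ c → inj₂ (≈-trans y x (check (numeral n)) t c x≈n)) ]′))

  -- Induction on `n` in the metatheory: the empty set and the successors that `v` is forced to
  -- contain equal the checked numerals by extensionality.
  numeral-ε-inductive : ∀ v p → Ext.Inductive v p → ∀ n q → q ≤ p →
                        Forces∈ (check (numeral n)) v q
  numeral-ε-inductive v p (empty , _) zero q q≤p = ε-local (check (numeral 0)) v q
    (DenseBelow-map q (DenseBelow-mono p q q≤p empty) λ r _ (e , e∈v , e-empty) →
      ε-congˡ e (check (numeral 0)) v r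
        (≈-ext e (check (numeral 0)) r
          (λ x s s≤r h → ⊥-elim (lower (e-empty x s s≤r h)))
          (λ x s _ h → ⊥-elim (¬ε-numeral-zero x s h)))
        e∈v)
  numeral-ε-inductive v p ind@(_ , step) (suc n) q q≤p = ε-local (check (numeral (suc n))) v q
    (DenseBelow-map q
      (step (check (numeral n)) q q≤p (numeral-ε-inductive v p ind n q q≤p))
      λ r _ (s , s∈v , s-suc) → ε-congˡ s (check (numeral (suc n))) v r
        (≈-ext s (check (numeral (suc n))) r
          (λ x t t≤r h → ε-numeral-suc⁺ x n t (proj₁ (s-suc x) t t≤r h))
          (λ x t t≤r h → proj₂ (s-suc x) t t≤r (ε-numeral-suc⁻ x n t h)))
        s∈v)

  check-ω-IsOmega : ∀ p → Ext.IsOmega (check ω) p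
  check-ω-IsOmega p = check-ω-inductive p , λ v q _ ind x r r≤q h →
    ε-local x v r (DenseBelow-map r (ε-check⁻ x ω r h) λ s s≤r (n , e) →
      ε-congˡ (check (numeral n)) x v s (≈-sym x (check (numeral n)) s e)
        (numeral-ε-inductive v q ind n s (transitive s r q s≤r r≤q)))

-- A countable name for the trace of `A` on an enumerated set.

module CountableSubname (em : ExcludedMiddle (lsuc 0ℓ)) (ℙ : Poset) (A : Forcing.Name ℙ)
                        (g : ℕ → V) (g-inj : Injective g) where
  open Poset ℙ
  open Forcing ℙ
  open ForcingProperties ℙ

  -- The value of select τ at a generic G is { τ n ^G : g n ∈ A^G }.
  select : (ℕ → Name) → Name
  select τ = name (Σ (ℕ × Ix carrier) λ (n , k) → True (em {Forces∈ (check (g n)) A (atom k)}))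
                  (λ ((n , _) , _) → τ n) (λ ((_ , k) , _) → atom k)

  ε-select⁻ : ∀ τ x p → Forces∈ x (select τ) p →
    DenseBelow (λ r → ∃ λ n → Forces≈ x (τ n) r × Forces∈ (check (g n)) A r) p
  ε-select⁻ τ x p h = DenseBelow-map p h λ r _ (((n , k) , t) , r≤k , e) →
    n , e , ε-mono (check (g n)) A (atom k) r r≤k (toWitness t)

  ε-select⁺ : ∀ τ x n p → Forces≈ x (τ n) p → Forces∈ (check (g n)) A p → Forces∈ x (select τ) p
  ε-select⁺ τ x n p e h q q≤p =
    -- Both inequalities matter: `k≤p` lets the atom itself force the membership, and `p≤k` puts `q`
    -- below the attached condition.
    let k , p≤k , k≤p = toAtom p
    in q , reflexive q , ((n , k) , fromWitness (ε-mono (check (g n)) A p (atom k) k≤p h)) ,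
       transitive q p (atom k) q≤p p≤k , ≈-mono x (τ n) p q q≤p e

  -- When `g` enumerates M, `trace` is the Ḃ of the header. `counting` names the restriction to it
  -- of the map sending `g n` to `n`, which witnesses countability.
  trace counting : Name
  trace    = select λ n → check (g n)
  counting = select λ n → pairᴺ (check (g n)) (check (numeral n))

  trace-⊑ : ∀ p → (trace Ext.⊑ A) p
  trace-⊑ p x q _ h = ε-local x A q
    (DenseBelow-map q (ε-select⁻ (λ n → check (g n)) x q h) λ r _ (n , e , d) →
      ε-congˡ (check (g n)) x A r (≈-sym x (check (g n)) r e) d)

  private
    Values : Name → Name → Cond → Set₁
    Values x y r = ∃ λ n → Forces≈ x (check (g n)) r × Forces≈ y (check (numeral n)) r

  counting⁻ : ∀ x y p → Ext.Related counting x y p → DenseBelow (Values x y) p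
  counting⁻ x y p h = DenseBelow-bind p h λ r _ (z , z∈f , pair) →
    DenseBelow-map r (ε-select⁻ (λ n → pairᴺ (check (g n)) (check (numeral n))) z r z∈f)
      λ q q≤r (n , e , _) →
      let gn = check (g n)
          d = ≈-trans (pairᴺ x y) z (pairᴺ gn (check (numeral n))) q
                (≈-sym z (pairᴺ x y) q (≈-mono z (pairᴺ x y) r q q≤r (IsPair⁻ z x y r pair))) e
      in n , pairᴺ-injectiveˡ x y gn (check (numeral n)) q d ,
             pairᴺ-injectiveʳ x y gn (check (numeral n)) q d

  counting⁺ : ∀ x n p → Forces≈ x (check (g n)) p → Forces∈ (check (g n)) A p →
              Ext.Related counting x (check (numeral n)) p
  counting⁺ x n p e h q q≤p =
    let z = pairᴺ (check (g n)) (check (numeral n)) in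
    q , reflexive q , z ,
    ε-select⁺ (λ n → pairᴺ (check (g n)) (check (numeral n))) z n q (≈-refl z q)
      (ε-mono (check (g n)) A p q q≤p h) ,
    IsPair⁺ z x (check (numeral n)) q
      (pairᴺ-cong (check (g n)) x (check (numeral n)) (check (numeral n)) q
        (≈-sym x (check (g n)) q (≈-mono x (check (g n)) p q q≤p e))
        (≈-refl (check (numeral n)) q))

  -- An equality of `check (g m)` and `check (g n)` forced by any condition holds in V, so
  -- injectivity of `g` identifies the two indices. In `counting-injective` the numerals take the
  -- place of `g`.
  counting-functional : ∀ x y y′ p → DenseBelow (Values x y) p → DenseBelow (Values x y′) p →
                        Forces≈ y y′ p
  counting-functional x y y′ p h h′ = ≈-local y y′ p (DenseBelow-bind p h
    λ r r≤p (m , x≈m , y≈m) → DenseBelow-map r (DenseBelow-mono p r r≤p h′)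
    λ q q≤r (n , x≈n , y′≈n) → same m n q
      (check-injective (g m) (g n) q (≈-trans (check (g m)) x (check (g n)) q
        (≈-sym x (check (g m)) q (≈-mono x (check (g m)) r q q≤r x≈m)) x≈n))
      (≈-mono y (check (numeral m)) r q q≤r y≈m) y′≈n)
    where
    same : ∀ m n q → g m ≐ g n → Forces≈ y (check (numeral m)) q →
           Forces≈ y′ (check (numeral n)) q → Forces≈ y y′ q
    same m n q e y≈m y′≈n with refl ← g-inj m n e =
      ≈-trans y (check (numeral m)) y′ q y≈m (≈-sym y′ (check (numeral m)) q y′≈n)

  counting-injective : ∀ x x′ y p → DenseBelow (Values x y) p → DenseBelow (Values x′ y) p →
                       Forces≈ x x′ p
  counting-injective x x′ y p h h′ = ≈-local x x′ p (DenseBelow-bind p h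
    λ r r≤p (m , x≈m , y≈m) → DenseBelow-map r (DenseBelow-mono p r r≤p h′)
    λ q q≤r (n , x′≈n , y≈n) → same m n q
      (check-injective (numeral m) (numeral n) q
        (≈-trans (check (numeral m)) y (check (numeral n)) q
          (≈-sym y (check (numeral m)) q (≈-mono y (check (numeral m)) r q q≤r y≈m)) y≈n))
      (≈-mono x (check (g m)) r q q≤r x≈m) x′≈n)
    where
    same : ∀ m n q → numeral m ≐ numeral n → Forces≈ x (check (g m)) q →
           Forces≈ x′ (check (g n)) q → Forces≈ x x′ q
    same m n q e x≈m x′≈n with refl ← numeral-injective {m} {n} e =
      ≈-trans x (check (g m)) x′ q x≈m (≈-sym x′ (check (g m)) q x′≈n)

  trace-countable : ∀ p → Ext.Countable trace p
  trace-countable p q _ =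
    q , reflexive q , check ω , check-ω-IsOmega q , λ r _ → r , reflexive r , counting ,
    ( (λ z s _ z∈f → DenseBelow-map s
        (ε-select⁻ (λ n → pairᴺ (check (g n)) (check (numeral n))) z s z∈f)
        λ t _ (n , e , d) → let gn = check (g n) in
        gn , ε-select⁺ (λ n → check (g n)) gn n t (≈-refl gn t) d ,
        λ u u≤t → u , reflexive u , check (numeral n) , check-numeral-ε-ω n u ,
        IsPair⁺ z gn (check (numeral n)) u
          (≈-mono z (pairᴺ gn (check (numeral n))) t u u≤t e))
    , (λ x s _ x∈B → DenseBelow-map s (ε-select⁻ (λ n → check (g n)) x s x∈B)
        λ t _ (n , e , d) → check (numeral n) , check-numeral-ε-ω n t , counting⁺ x n t e d)
    , λ x y y′ s _ h t t≤s h′ → counting-functional x y y′ t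
        (DenseBelow-mono s t t≤s (counting⁻ x y s h)) (counting⁻ x y′ t h′))
    , λ x x′ y s _ h t t≤s h′ → counting-injective x x′ y t
        (DenseBelow-mono s t t≤s (counting⁻ x y s h)) (counting⁻ x′ y t h′)

-- Preservation of countable tightness.

module Preservation
  (em : ExcludedMiddle (lsuc 0ℓ)) (θ : V)
  (𝕏 : TopSpace) (X∈H : H θ (TopSpace.X 𝕏))
  (ℙ : Poset) (ℙ∈H : H θ (Poset.carrier ℙ))
  (tight : IsCountablyTight 𝕏)
  where
  open TopSpace 𝕏 using (X; τ; τ⊆𝒫X; X-open)
  open Poset ℙ
  open Forcing ℙ
  open ForcingProperties ℙ
  open Classical em

  Open : Name → Cond → Set₁
  Open = Ext.OpenGeneratedBy (check X) (check τ)

  check-open : ∀ W p → W ∈ τ → Open (check W) p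
  check-open W p W∈τ =
    check-⊑ W X p (τ⊆𝒫X W W∈τ) ,
    λ z q _ z∈W r r≤q → r , reflexive r , check W , check-∈ W τ r W∈τ ,
      ε-mono z (check W) q r r≤q z∈W , check-⊑ W W r (λ _ d → d)

  -- `σ` names the point under consideration, and `q` has already decided it to be `x`.
  module _ (A σ : Name) (x : V) (x∈X : x ∈ X) (q : Cond)
           (σ≈x : Forces≈ σ (check x) q)
           (σ∈clA : Ext.InClosure Open σ A q) where

    -- An answer to `r` in the sense of the header. Testing the open sets of V suffices, because `τ`
    -- is a basis of the topology in the extension.
    Approximates : Cond → (ℕ → V) → (ℕ → Cond) → Set₁
    Approximates r y s =
      (∀ n → y n ∈ X × s n ≤ r × Forces∈ (check (y n)) A (s n)) ×
      (∀ W → W ∈ τ → x ∈ W → ∃ λ n → y n ∈ W)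

    -- E(r) of the header.
    possible : Cond → V
    possible r = separate X λ i → ∃ λ s → s ≤ r × Forces∈ (check (el X i)) A s

    possible-⊆ : ∀ r y → y ∈ possible r →
                 y ∈ X × (∃ λ s → s ≤ r × Forces∈ (check y) A s)
    possible-⊆ r y ((i , t) , e) =
      let s , s≤r , h = toWitness t
      in (i , e) , s , s≤r ,
         ε-congˡ (check (el X i)) (check y) A s
           (check-cong (el X i) y s (≐-sym y (el X i) e)) h

    -- A common extension `u` of `r` and `q` forces `W` to meet `A`. A stronger condition decides a
    -- point of the intersection, and it witnesses that this point is possible, being below `r`.
    possible-closure : ∀ r → Compatible r q →
      InV.InClosure (λ U → Lift (lsuc 0ℓ) (U ∈ τ)) x (possible r)
    possible-closure r (u , u≤r , u≤q) W (lift W∈τ) (lift x∈W) =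
      let v , v≤u , y , y∈A , y∈W = σ∈clA (check W) u u≤q (check-open W u W∈τ) u (reflexive u)
            (ε-check⁺ σ x W u x∈W (≈-mono σ (check x) q u u≤q σ≈x)) u (reflexive u)
          w , w≤v , i , y≈ = ε-check⁻ y W v y∈W v (reflexive v)
          -- `possible r` is indexed by `Ix X`, so the point of `W` has to be located in `X`.
          k , d = τ⊆𝒫X W W∈τ (el W i) (el-∈ W i)
      in el W i ,
         lift ((k , fromWitness (w , transitive w v r w≤v (transitive v u r v≤u u≤r) ,
           ε-congˡ y (check (el X k)) A w
             (≈-trans y (check (el W i)) (check (el X k)) w y≈ (check-cong (el W i) (el X k) w d))
             (ε-mono y A v w w≤v y∈A))) , d) ,
         lift (el-∈ W i)

    approximation : ∀ r → Compatible r q → ∃ λ y → ∃ λ s → Approximates r y s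
    approximation r r∥q =
      let B , B⊆E , B-countable , x∈clB = tight x (lift x∈X) (possible r)
            (λ y (lift y∈E) → lift (proj₁ (possible-⊆ r y y∈E))) (possible-closure r r∥q)
          -- `X` is itself a neighbourhood of `x`, so `B` is nonempty; `b` becomes the default value
          -- of the enumeration.
          b , lift b∈B , _ = x∈clB X (lift X-open) (lift x∈X)
          y , y-∈ , y-onto = countable⇒enumeration b B b∈B B-countable
          good = λ n → possible-⊆ r (y n) (lower (B⊆E (y n) (lift (y-∈ n))))
      in y , (λ n → proj₁ (proj₂ (good n))) , (λ n → proj₁ (good n) , proj₂ (proj₂ (good n))) ,
         λ W W∈τ x∈W →
           let z , lift z∈B , lift z∈W = x∈clB W (lift W∈τ) (lift x∈W)
               n , e = y-onto z z∈B
           in n , ∈-congˡ z (y n) W e z∈W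

    -- Some answer inside `M` is demanded, not closure under one fixed answering function:
    -- `approximation` takes a `Cond` with its membership proof and might not respect `≐`.
    C : Class
    C M = [ H θ ]^ℵ₀ M × proj₁ q ∈ M ×
      (∀ r → proj₁ r ∈ M → Compatible r q →
        ∃ λ y → ∃ λ s → Approximates r y s × (∀ n → y n ∈ M × proj₁ (s n) ∈ M))

    Answerable : V → Set₁
    Answerable w = ∃ λ r → proj₁ r ≐ w × Compatible r q

    -- Packs both sequences of an answer into one function: tag `0` selects the points, any other
    -- tag the conditions. If `w` is not a condition compatible with `q`, the value defaults to `q`,
    -- which keeps it in `H θ`.
    answer : ∀ w → Dec (Answerable w) → ℕ × ℕ → V
    answer w (no _)              _           = proj₁ q
    answer w (yes (r , _ , r∥q)) (zero , n)  = proj₁ (approximation r r∥q) n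
    answer w (yes (r , _ , r∥q)) (suc _ , n) = proj₁ (proj₁ (proj₂ (approximation r r∥q)) n)

    carrier⇒H : ∀ (p : Cond) → H θ (proj₁ p)
    carrier⇒H (z , z∈) = H-transitive θ z carrier z∈ ℙ∈H

    answer-∈H : ∀ w d m → H θ (answer w d m)
    answer-∈H w (no _) _ = carrier⇒H q
    answer-∈H w (yes (r , _ , r∥q)) (zero , n) =
      let y , _ , good , _ = approximation r r∥q
      in H-transitive θ (y n) X (proj₁ (good n)) X∈H
    answer-∈H w (yes (r , _ , r∥q)) (suc _ , n) =
      carrier⇒H (proj₁ (proj₂ (approximation r r∥q)) n)

    -- The decision may hold another condition `r′` with the same underlying set as `r`. Its answer
    -- also serves `r`, since the order sees only underlying sets.
    answer-approximates : ∀ w d r → proj₁ r ≐ w → Compatible r q →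
      ∃ λ y → ∃ λ s → Approximates r y s ×
        (∀ n → y n ≡ answer w d (0 , n) × proj₁ (s n) ≡ answer w d (1 , n))
    answer-approximates w (no ¬d) r e r∥q = contradiction (r , e , r∥q) ¬d
    answer-approximates w (yes (r′ , e′ , r′∥q)) r e r∥q =
      let y , s , good , acc = approximation r′ r′∥q
          r′≐r = ≐-trans (proj₁ r′) w (proj₁ r) e′ (≐-sym (proj₁ r) w e)
      in y , s ,
         ((λ n → let y∈ , s≤ , h = good n in y∈ , ≤-congʳ (s n) r′ r r′≐r s≤ , h) , acc) ,
         λ n → refl , refl

    -- Stage 0 lists `q` and `a`, and each later stage lists the entries of the answers to all
    -- elements of the stage before. An answer to an element of one stage thus lies in the next, and
    -- `M` collects all stages.
    C-unbounded : ∀ a → [ H θ ]^ℵ₀ a → ∃ λ M → C M × a ⊆ M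
    C-unbounded a (a⊆H , a-bij) =
      M , ((M⊆H , enumeration⇒bijection _ M (proj₁ (proj₂ M-enum)) (proj₂ (proj₂ M-enum))) ,
           M-∈ 0 0 , closed) ,
      λ z z∈a → let n , e = g₀-onto z z∈a in (0 , suc n) , e
      where
      g₀ = proj₁ (bijection⇒enumeration a a-bij)
      g₀-∈ = proj₁ (proj₁ (proj₂ (bijection⇒enumeration a a-bij)))
      g₀-onto = proj₂ (proj₁ (proj₂ (bijection⇒enumeration a a-bij)))
      g₀-inj = proj₂ (proj₂ (bijection⇒enumeration a a-bij))

      stage : ℕ → ℕ → V
      -- Position 0 is reserved for `q`, so the elements of `a` are shifted by one.
      stage zero    zero    = proj₁ q
      stage zero    (suc n) = g₀ n
      -- `n` codes a position `i` in stage `k` and a number `m`, which in turn codes a tag and a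
      -- position in the answer.
      stage (suc k) n = let i , m = unpair n ; w = stage k i in answer w em (unpair m)

      M = sup (ℕ × ℕ) λ (k , n) → stage k n

      M-∈ : ∀ k n → stage k n ∈ M
      M-∈ k n = (k , n) , ≐-refl (stage k n)

      stage-∈H : ∀ k n → H θ (stage k n)
      stage-∈H zero    zero    = carrier⇒H q
      stage-∈H zero    (suc n) = a⊆H (g₀ n) (g₀-∈ n)
      stage-∈H (suc k) n       = answer-∈H _ em _

      M⊆H : ∀ z → z ∈ M → H θ z
      M⊆H z ((k , n) , e) with stage-∈H k n
      ... | α , α∈θ , h =
        α , α∈θ , ≼-⊆ (trcl z) (trcl (stage k n)) α (trcl-cong z (stage k n) e) h

      M-enum : ∃ λ g → IsEnumeration g M × Injective g
      -- Running through all stages may repeat values; the injective sequence `g₀`, listed in stage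
      -- 0, supplies the replacements.
      M-enum = injectiveEnumeration M (λ n → let k , i = unpair n in stage k i) g₀
        ((λ n → let k , i = unpair n in M-∈ k i) , λ { z ((k , i) , e) →
          let n , n≡ = unpair-surjective k i
          in n , subst (λ (k , i) → z ≐ stage k i) (sym n≡) e })
        (λ n → M-∈ 0 (suc n)) g₀-inj

      answer-∈M : ∀ k i b n → answer (stage k i) em (b , n) ∈ M
      answer-∈M k i b n =
        let m , m≡ = unpair-surjective b n ; l , l≡ = unpair-surjective i m
        in subst (_∈ M) (reach m l m≡ l≡) (M-∈ (suc k) l)
        where
        reach : ∀ m l → unpair m ≡ (b , n) → unpair l ≡ (i , m) →
                stage (suc k) l ≡ answer (stage k i) em (b , n)
        reach m l m≡ l≡ rewrite l≡ | m≡ = refl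

      closed : ∀ r → proj₁ r ∈ M → Compatible r q →
        ∃ λ y → ∃ λ s → Approximates r y s × (∀ n → y n ∈ M × proj₁ (s n) ∈ M)
      closed r ((k , i) , e) r∥q =
        let y , s , approx , eqs = answer-approximates (stage k i) em r e r∥q
        in y , s , approx , λ n → let y≡ , s≡ = eqs n in
           subst (_∈ M) (sym y≡) (answer-∈M k i 0 n) ,
           subst (_∈ M) (sym s≡) (answer-∈M k i 1 n)

    -- A condition in the union lies in some `c k`, and the answer found there stays in the union.
    -- The enumerations of all `c k` are merged by `unpair`, with that of `c 0` supplying
    -- replacements for repeated values.
    C-closed : (c : ℕ → V) → (∀ n → C (c n)) → (∀ n → c n ⊆ c (suc n)) → C (⋃ (sup ℕ c))
    C-closed c c∈C _ =
      ((λ { z ((k , j) , e) → proj₁ (proj₁ (c∈C k)) z (j , e) }) ,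
       enumeration⇒bijection _ ⋃c (proj₁ (proj₂ ⋃-enum)) (proj₂ (proj₂ ⋃-enum))) ,
      ⋃-∈ 0 (proj₁ q) (proj₁ (proj₂ (c∈C 0))) ,
      λ { r ((k , j) , e) r∥q →
        let y , s , approx , y,s∈ = proj₂ (proj₂ (c∈C k)) r (j , e) r∥q
        in y , s , approx , λ n → ⋃-∈ k (y n) (proj₁ (y,s∈ n)) ,
                                   ⋃-∈ k (proj₁ (s n)) (proj₂ (y,s∈ n)) }
      where
      ⋃c = ⋃ (sup ℕ c)
      ⋃-∈ : ∀ k z → z ∈ c k → z ∈ ⋃c
      ⋃-∈ k z (j , e) = (k , j) , e
      enum : ∀ k → ∃ λ g → IsEnumeration g (c k) × Injective g
      enum k = bijection⇒enumeration (c k) (proj₂ (proj₁ (c∈C k)))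
      ⋃-enum : ∃ λ g → IsEnumeration g ⋃c × Injective g
      ⋃-enum = injectiveEnumeration ⋃c (λ n → let k , i = unpair n in proj₁ (enum k) i)
        (proj₁ (enum 0))
        ((λ n → let k , i = unpair n in
            ⋃-∈ k (proj₁ (enum k) i) (proj₁ (proj₁ (proj₂ (enum k))) i)) ,
         λ { z ((k , j) , e) →
           let i , d = proj₂ (proj₁ (proj₂ (enum k))) z (j , e)
               n , n≡ = unpair-surjective k i
           in n , subst (λ (k , i) → z ≐ proj₁ (enum k) i) (sym n≡) d })
        (λ n → ⋃-∈ 0 (proj₁ (enum 0) n) (proj₁ (proj₁ (proj₂ (enum 0))) n))
        (proj₂ (proj₂ (enum 0)))

    C-extensional : ∀ {M N} → M ≐ N → C M → C N
    C-extensional {M} {N} e ((M⊆H , M-bij) , q∈M , closed) =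
      let g , (g-∈ , g-onto) , g-inj = bijection⇒enumeration M M-bij in
      ((λ z z∈N → M⊆H z (N⊆M z z∈N)) ,
       enumeration⇒bijection g N
         ((λ n → M⊆N (g n) (g-∈ n)) , λ z z∈N → g-onto z (N⊆M z z∈N)) g-inj) ,
      M⊆N (proj₁ q) q∈M ,
      λ r r∈N r∥q →
        let y , s , approx , y,s∈ = closed r (N⊆M (proj₁ r) r∈N) r∥q
        in y , s , approx , λ n →
           M⊆N (y n) (proj₁ (y,s∈ n)) , M⊆N (proj₁ (s n)) (proj₂ (y,s∈ n))
      where
      M⊆N : M ⊆ N
      M⊆N z = ∈-congʳ z M N e
      N⊆M : N ⊆ M
      N⊆M z = ∈-congʳ z N M (≐-sym M N e)

    C-club : Club (H θ) C
    C-club = record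
      { extensional = C-extensional
      ; subclass    = λ _ → proj₁
      ; unbounded   = C-unbounded
      ; closed      = C-closed
      }

    -- The trace below a strongly generic condition.

    module _ (M : V) (M∈C : C M) (p : Cond) (p≤q : p ≤ q) (p-generic : StronglyGeneric M p) where

      private
        enum = bijection⇒enumeration M (proj₂ (proj₁ M∈C))
        g = proj₁ enum
        g-onto = proj₂ (proj₁ (proj₂ enum))

      open CountableSubname em ℙ A g (proj₂ (proj₂ enum))

      trace-closure : Ext.InClosure Open σ trace p
      trace-closure U r₀ r₀≤p (_ , U-nbhd) r₁ r₁≤r₀ σ∈U r₂ r₂≤r₁ =
        -- A basic neighbourhood inside `U` is first obtained as a name `W′` and then decided to be
        -- some `W` in `τ`; the deciding condition `r₄` is the r of the header.
        let r₃ , r₃≤r₂ , W′ , W′∈τ , σ∈W′ , W′⊑U =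
              U-nbhd σ r₁ r₁≤r₀ σ∈U r₂ r₂≤r₁
            r₄ , r₄≤r₃ , i , W′≈W = ε-check⁻ W′ τ r₃ W′∈τ r₃ (reflexive r₃)
            W = el τ i
            r₄≤r₂ = transitive r₄ r₃ r₂ r₄≤r₃ r₃≤r₂
            r₄≤p = transitive r₄ r₂ p r₄≤r₂
                     (transitive r₂ r₁ p r₂≤r₁ (transitive r₁ r₀ p r₁≤r₀ r₀≤p))
            r₄≤q = transitive r₄ p q r₄≤p p≤q
            -- Forced membership between checked sets is true in V, which is where `accumulates`
            -- needs it.
            x∈W = check-∈⁻ x W r₄
              (ε-congˡ σ (check x) (check W) r₄ (≈-mono σ (check x) q r₄ r₄≤q σ≈x)
                (ε-congʳ σ W′ (check W) r₄ W′≈W (ε-mono σ W′ r₃ r₄ r₄≤r₃ σ∈W′)))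
            r̄ , r̄∈M , residue = p-generic r₄ r₄≤p
            -- The residue property at `r̄` itself makes `r̄` compatible with `r₄`, hence with `q`;
            -- only then does `M∈C` provide an answer to `r̄` inside `M`.
            u , u≤r̄ , u≤r₄ = residue r̄ r̄∈M (reflexive r̄)
            y , s , (good , accumulates) , y,s∈M =
              proj₂ (proj₂ M∈C) r̄ r̄∈M (u , u≤r̄ , transitive u r₄ q u≤r₄ r₄≤q)
            n , yₙ∈W = accumulates W (el-∈ τ i) x∈W
            _ , sₙ≤r̄ , sₙ⊩yₙ∈A = good n
            t , t≤sₙ , t≤r₄ = residue (s n) (proj₂ (y,s∈M n)) sₙ≤r̄
            -- As a member of `M`, the point `y n` has an index `m` in the enumeration on which
            -- `trace` is built.
            m , yₙ≐ = g-onto (y n) (proj₁ (y,s∈M n))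
            yₙ = check (y n)
            yₙ≈ = check-cong (y n) (g m) t yₙ≐
        in t , transitive t r₄ r₂ t≤r₄ r₄≤r₂ , yₙ ,
           ε-select⁺ (λ n → check (g n)) yₙ m t yₙ≈
             (ε-congˡ yₙ (check (g m)) A t yₙ≈ (ε-mono yₙ A (s n) t t≤sₙ sₙ⊩yₙ∈A)) ,
           W′⊑U yₙ t (transitive t r₄ r₃ t≤r₄ r₄≤r₃)
             (ε-congʳ yₙ (check W) W′ t
               (≈-sym W′ (check W) t (≈-mono W′ (check W) r₄ t t≤r₄ W′≈W))
               (check-∈ (y n) W t yₙ∈W))

      countableSubname : ∃ λ B → (B Ext.⊑ A) p × Ext.Countable B p × Ext.InClosure Open σ B p
      countableSubname = trace , trace-⊑ p , trace-countable p , trace-closure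

theorem4p8 : ExcludedMiddle (lsuc 0ℓ) → Choice →
    (θ : V) → RegularCardinal θ →
    (𝕏 : TopSpace) → H θ (TopSpace.code 𝕏) →
    (ℙ : Poset) → H θ (Poset.code ℙ) →
    LargeEnough θ 𝕏 ℙ →
    IsCountablyTight 𝕏 →
    StationaryIn (H θ)
    (λ M → [ H θ ]^ℵ₀ M × M ≺ H θ × Poset.StronglyProperFor ℙ M) →
    ForcesCountablyTight ℙ 𝕏
theorem4p8 em _ θ _ 𝕏 𝕏∈H ℙ ℙ∈H _ tight stationary p σ q q≤p σ∈X A q₁ q₁≤q A⊑X q₂ q₂≤q₁ σ∈clA q₃ q₃≤q₂ =
  -- The last condition `q₃` comes from the density statement for the existential quantifier, so the
  -- witness must be found below it.
  let q₃≤q = transitive q₃ q₂ q q₃≤q₂ (transitive q₂ q₁ q q₂≤q₁ q₁≤q)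
      -- Decides which point of `X` is named by `σ`.
      q₄ , q₄≤q₃ , i , σ≈x = ε-check⁻ σ X q σ∈X q₃ q₃≤q
      x = el X i
      σ∈clA₄ = λ U r r≤q₄ → σ∈clA U r (transitive r q₃ q₂ (transitive r q₄ q₃ r≤q₄ q₄≤q₃) q₃≤q₂)
      -- The members of this club contain `q₄`, so strong properness for `M` applies to `q₄` and
      -- yields the strongly generic `r` below it.
      M , M∈C , _ , _ , _ , proper =
        stationary (C A σ x (el-∈ X i) q₄ σ≈x σ∈clA₄)
                   (C-club A σ x (el-∈ X i) q₄ σ≈x σ∈clA₄)
      r , r≤q₄ , r-generic = proper q₄ (proj₁ (proj₂ M∈C))
  in r , transitive r q₄ q₃ r≤q₄ q₄≤q₃ ,
     countableSubname A σ x (el-∈ X i) q₄ σ≈x σ∈clA₄ M M∈C r r≤q₄ r-generic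
  where
  open TopSpace 𝕏 using (X; τ)
  open Poset ℙ
  open ForcingProperties ℙ
  open Preservation em θ 𝕏 (first-∈H θ X τ 𝕏∈H) ℙ (first-∈H θ carrier order ℙ∈H) tight
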